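{- Let $k\geq 1$ be an integer. (i) For any $s<2-\frac{2}{k+1}$, there exist sets $E\subset\mathbb{F}_q^2$ (for $q$ a power of an odd prime) such that $|E|\approx q^s$ and $|\mathcal{C}_{k+1}(E)|=o(|\mathcal{C}_{k+1}(\mathbb{F}_q^2)|)$. (ii) For any $s<2-\min\left(\frac{2}{k+1},\frac{1}{\ell}\right)$, there exist sets $E\subset(\mathbb{Z}/p^\ell\mathbb{Z})^2$ (for $p$ an odd prime and $\ell\geq 1$) such that $|E|\approx p^{\ell s}$ and $|\mathcal{C}_{k+1}(E)|=o(|\mathcal{C}_{k+1}((\mathbb{Z}/p^\ell\mathbb{Z})^2)|)$.
   Context: For a commutative ring $R$ and $x=(x_1,x_2),y=(y_1,y_2)\in R^2$, write $y^\perp=(y_2,-y_1)$, so $x\cdot y^\perp=x_1y_2-x_2y_1$. A $(k+1)$-point configuration is an element $x=(x^1,\dots,x^{k+1})\in (R^2)^{k+1}$. For $E\subset R^2$, define an equivalence relation $\sim$ on $E^{k+1}$ by $x\sim y$ iff $x^i\cdot x^{j\perp}=y^i\cdot y^{j\perp}$ for every pair of indices $i,j$; $\mathcal{C}_{k+1}(E)$ denotes the set of equivalence classes of $E^{k+1}$ under $\sim$. $X\approx Y$ means $X\leq CY$ and $Y\leq CX$ for a constant $C$ independent of the ring size; $o(Y)$ denotes a quantity whose ratio to $Y$ tends to $0$ as the size of the ring ($q$, resp. $p$) tends to infinity.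
   Formalization: The formal statement assumes s ≥ 0 in both parts; for s < 0 no sets E with |E| ≈ q^s (resp. p^{ℓs}) exist, since E would be nonempty while C q^s tends to 0. -}

module Defs where

open import Level using (Level; 0ℓ)
open import Algebra.Bundles using (CommutativeRing)
open import Data.Fin.Base using (Fin)
open import Data.Integer.Base as Int using (ℤ; +_; -[1+_])
import Data.Integer.Properties as ℤₚ
import Data.Integer.Divisibility.Signed as Div
open import Data.Integer.Tactic.RingSolver using (solve-∀)
open import Data.Nat.Base as ℕ using (ℕ; suc)
open import Data.Nat.Divisibility using (_∤_)
open import Data.Nat.Primality using (Prime)
open import Data.Product.Base using (Σ; ∃; ∃-syntax; ∃₂; _×_; _,_; proj₁)
open import Data.Product.Relation.Binary.Pointwise.NonDependent using (×-setoid)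
open import Data.Rational.Base as ℚ using (ℚ; 0ℚ; ↥_; ↧ₙ_)
open import Data.Sum.Base using (_⊎_)
open import Data.Unit.Base using (⊤; tt)
open import Data.Vec.Functional using (Vector)
open import Function.Bundles using (Inverse)
open import Relation.Binary.Bundles using (Setoid)
import Relation.Binary.Construct.On as On
open import Relation.Binary.Definitions using (_Respects_)
open import Relation.Binary.PropositionalEquality as ≡ using (_≡_)
open import Relation.Nullary.Negation using (¬_)
open import Relation.Unary using (Pred)

private variable
  a ℓ i : Level

-- Sets are setoids; in particular a quotient set is a setoid whose equality
-- is the equivalence relation, so its size is the number of classes.
_HasSize_ : Setoid a ℓ → ℕ → Set _
S HasSize n = Inverse (≡.setoid (Fin n)) S

-- Located Dedekind cuts: `Lower r` means r < s and `Upper r` means s < r.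
record ℝ : Set₁ where
  field
    Lower Upper     : Pred ℚ 0ℓ
    lower-inhabited : ∃ Lower
    upper-inhabited : ∃ Upper
    lower-closed    : ∀ {p r} → p ℚ.< r → Lower r → Lower p
    upper-closed    : ∀ {p r} → p ℚ.< r → Upper p → Upper r
    lower-open      : ∀ {p} → Lower p → ∃[ r ] p ℚ.< r × Lower r
    upper-open      : ∀ {r} → Upper r → ∃[ p ] p ℚ.< r × Upper p
    disjoint        : ∀ {r} → ¬ (Lower r × Upper r)
    located         : ∀ {p r} → p ℚ.< r → Lower p ⊎ Upper r

infix 4 _<ᵣ_ _≤ᵣ_

_<ᵣ_ : ℝ → ℚ → Set
s <ᵣ r = ℝ.Upper s r

_≤ᵣ_ : ℚ → ℝ → Set
r ≤ᵣ s = ¬ (s <ᵣ r)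

pos neg : ℤ → ℕ
pos (+ n)    = n
pos -[1+ n ] = 0
neg (+ n)    = 0
neg -[1+ n ] = suc n

-- For r = n / d and b ≥ 1, these say  X ≤ C · b ^ r  and  b ^ r ≤ C · X
-- respectively: both sides are raised to the power d, and a negative power
-- of b is moved to the other side.
_≤_·_^ℚ_ : ℕ → ℕ → ℕ → ℚ → Set
X ≤ C · b ^ℚ r =
  X ℕ.^ (↧ₙ r) ℕ.* b ℕ.^ neg (↥ r) ℕ.≤ C ℕ.^ (↧ₙ r) ℕ.* b ℕ.^ pos (↥ r)

_^ℚ_≤_·_ : ℕ → ℚ → ℕ → ℕ → Set
b ^ℚ r ≤ C · X =
  b ℕ.^ pos (↥ r) ℕ.≤ (C ℕ.* X) ℕ.^ (↧ₙ r) ℕ.* b ℕ.^ neg (↥ r)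

-- For b ≥ 1, the real number b ^ s is the infimum of b ^ r over rationals
-- r > s, and the supremum of b ^ r over rationals r < s.
_≤_·_^ℝ_ : ℕ → ℕ → ℕ → ℝ → Set
X ≤ C · b ^ℝ s = ∀ r → ℝ.Upper s r → X ≤ C · b ^ℚ r

_^ℝ_≤_·_ : ℕ → ℝ → ℕ → ℕ → Set
b ^ℝ s ≤ C · X = ∀ r → ℝ.Lower s r → b ^ℚ r ≤ C · X

-- |S i| ≈ (b i) ^ s.  Taking C natural loses nothing, as C may be enlarged.
Size_≈_^_ : {I : Set i} → (I → Setoid a ℓ) → (I → ℕ) → ℝ → Set _
Size S ≈ b ^ s =
  ∃[ C ] ∀ i → ∃[ m ] (S i HasSize m)
                    × (m ≤ C · b i ^ℝ s)
                    × (b i ^ℝ s ≤ C · m)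

-- |S i| = o(|T i|) as b i → ∞
Size_≪_as_→∞ : {I : Set i} → (I → Setoid a ℓ) → (I → Setoid a ℓ) →
               (I → ℕ) → Set _
Size S ≪ T as b →∞ =
  ∀ (ε : ℚ) → 0ℚ ℚ.< ε → ∃[ N ] ∀ i → N ℕ.≤ b i →
    ∃₂ λ m n → (S i HasSize m) × (T i HasSize n)
             × (+ m ℚ./ 1) ℚ.≤ ε ℚ.* (+ n ℚ./ 1)

module Plane (R : CommutativeRing 0ℓ 0ℓ) where
  open CommutativeRing R

  Point : Setoid 0ℓ 0ℓ
  Point = ×-setoid setoid setoid

  R² : Set
  R² = Setoid.Carrier Point

  infix 9 _⊥
  infix 8 _∙_

  _⊥ : R² → R²
  (y₁ , y₂) ⊥ = y₂ , - y₁

  _∙_ : R² → R² → Carrier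
  (x₁ , x₂) ∙ (y₁ , y₂) = x₁ * y₁ + x₂ * y₂

  record Subset : Set₁ where
    field
      _∋_      : Pred R² 0ℓ
      respects : _∋_ Respects Setoid._≈_ Point

  full : Subset
  full = record { _∋_ = λ _ → ⊤ ; respects = λ _ _ → tt }

  ⟦_⟧ : Subset → Setoid 0ℓ 0ℓ
  ⟦ E ⟧ = On.setoid {B = Σ R² (Subset._∋_ E)} Point proj₁

  Configuration : ℕ → Subset → Set
  Configuration n E = Vector (Setoid.Carrier ⟦ E ⟧) n

  _∼_ : ∀ {n E} → Configuration n E → Configuration n E → Set
  x ∼ y = ∀ i j → proj₁ (x i) ∙ proj₁ (x j) ⊥ ≈ proj₁ (y i) ∙ proj₁ (y j) ⊥

  𝒞 : ℕ → Subset → Setoid 0ℓ 0ℓ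
  𝒞 n E = record
    { Carrier       = Configuration n E
    ; _≈_           = _∼_ {n} {E}
    ; isEquivalence = record
      { refl  = λ i j → refl
      ; sym   = λ p i j → sym (p i j)
      ; trans = λ p q i j → trans (p i j) (q i j)
      }
    }

open Plane public using (Subset; full; 𝒞) renaming (⟦_⟧ to ⟦_∣_⟧)

record IsField (R : CommutativeRing 0ℓ 0ℓ) : Set where
  open CommutativeRing R
  field
    1≉0     : ¬ (1# ≈ 0#)
    inverse : ∀ x → ¬ (x ≈ 0#) → ∃[ y ] x * y ≈ 1#

record OddPrime : Set where
  field
    p       : ℕ
    isPrime : Prime p
    odd     : 2 ∤ p

open OddPrime public using (p)

-- Any field with q = p ^ n elements; it is 𝔽_q, up to isomorphism.
record OddFiniteField : Set₁ where
  field
    oddPrime : OddPrime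
    n        : ℕ
    1≤n      : 1 ℕ.≤ n
  q : ℕ
  q = p oddPrime ℕ.^ n
  field
    ring     : CommutativeRing 0ℓ 0ℓ
    isField  : IsField ring
    size     : CommutativeRing.setoid ring HasSize q

open OddFiniteField public using () renaming (ring to 𝔽; q to ∣𝔽∣)

module _ (n : ℕ) where
  open Int using (_+_; _*_; -_; _-_)
  open Div

  _≡ₘ_ : ℤ → ℤ → Set
  x ≡ₘ y = + n ∣ x - y

  private
    by : ∀ {x y} → x ≡ y → + n ∣ x → + n ∣ y
    by = ≡.subst (+ n ∣_)

    reflₘ : ∀ {x y} → x ≡ y → x ≡ₘ y
    reflₘ {x} ≡.refl = by (≡.sym (ℤₚ.+-inverseʳ x)) (divides (+ 0) ≡.refl)

    neg-diff : ∀ x y → - (x - y) ≡ y - x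
    neg-diff = solve-∀

    trans-diff : ∀ x y z → (x - y) + (y - z) ≡ x - z
    trans-diff = solve-∀

    +-diff : ∀ x y u v → (x - y) + (u - v) ≡ (x + u) - (y + v)
    +-diff = solve-∀

    *-diff : ∀ x y u v → u * (x - y) + y * (u - v) ≡ x * u - y * v
    *-diff = solve-∀

    -‿diff : ∀ x y → - (x - y) ≡ - x - - y
    -‿diff = solve-∀

  ℤ/_ : CommutativeRing 0ℓ 0ℓ
  ℤ/_ = record
    { Carrier = ℤ
    ; _≈_ = _≡ₘ_
    ; _+_ = _+_
    ; _*_ = _*_
    ; -_  = -_
    ; 0#  = + 0
    ; 1#  = + 1
    ; isCommutativeRing = record
      { isRing = record
        { +-isAbelianGroup = record
          { isGroup = record
            { isMonoid = record
              { isSemigroup = record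
                { isMagma = record
                  { isEquivalence = record
                    { refl  = λ {x} → reflₘ {x} ≡.refl
                    ; sym   = λ {x} {y} d → by (neg-diff x y) (∣m⇒∣-m d)
                    ; trans = λ {x} {y} {z} d e →
                        by (trans-diff x y z) (∣m∣n⇒∣m+n d e)
                    }
                  ; ∙-cong = λ {x} {y} {u} {v} d e →
                      by (+-diff x y u v) (∣m∣n⇒∣m+n d e)
                  }
                ; assoc = λ x y z → reflₘ (ℤₚ.+-assoc x y z)
                }
              ; identity = (λ x → reflₘ (ℤₚ.+-identityˡ x))
                         , (λ x → reflₘ (ℤₚ.+-identityʳ x))
              }
            ; inverse = (λ x → reflₘ (ℤₚ.+-inverseˡ x))
                      , (λ x → reflₘ (ℤₚ.+-inverseʳ x))
            ; ⁻¹-cong = λ {x} {y} d → by (-‿diff x y) (∣m⇒∣-m d)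
            }
          ; comm = λ x y → reflₘ (ℤₚ.+-comm x y)
          }
        ; *-cong = λ {x} {y} {u} {v} d e →
            by (*-diff x y u v) (∣m∣n⇒∣m+n (∣n⇒∣m*n u d) (∣n⇒∣m*n y e))
        ; *-assoc = λ x y z → reflₘ (ℤₚ.*-assoc x y z)
        ; *-identity = (λ x → reflₘ (ℤₚ.*-identityˡ x))
                     , (λ x → reflₘ (ℤₚ.*-identityʳ x))
        ; distrib = (λ x y z → reflₘ (ℤₚ.*-distribˡ-+ x y z))
                  , (λ x y z → reflₘ (ℤₚ.*-distribʳ-+ x y z))
        }
      ; *-comm = λ x y → reflₘ (ℤₚ.*-comm x y)
      }
    }

{-# OPTIONS --safe #-}
-- Configurations x and g x are equivalent for g ∈ SL₂.  Let q be the size of the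
-- ring.  The whole plane has at least about q ^ (2k - 1) classes, since
-- (1 , 0), (0 , unit), x³, …, xᵏ⁺¹ are pairwise inequivalent.
--
-- If s < 2 - 2 / (k + 1), take E = R × A with A a set of about q ^ (s - 1) units
-- (or a subset of the axis x₂ = 0, which has a single class, when q ^ s ≤ q).
-- Shears preserve E, so it has at most |A| ^ (k + 1) q ^ k classes.
--
-- If s < 2 - 1 / ℓ in ℤ/p^ℓ, take E inside the strip of points (unit , p c).
-- SL₂ moves the zeroth point to (1 , 0) and the others to (x i , p ^ (1 + w) d i)
-- with w maximal.  Then some d i is a unit (or all determinants vanish), so
-- x i can be killed by adding a multiple of d to x, and only residues
-- modulo p ^ (ℓ - 1) matter: there are O(p ^ ((ℓ - 1) (2k - 1))) classes.

module Submission where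

open import Defs

-- The thresholds come from comparing exponents. Rows with about q ^ s points have at most about q ^
-- ((k + 1) s - 1) classes, and this is below q ^ (2k - 1) exactly when s < 2 - 2 / (k + 1). The
-- strip has about q p ^ (ℓ - 1) = q ^ (2 - 1/ℓ) points, and whatever part of it is taken, the bound
-- on its classes falls short of the plane's count by the power p ^ (2k - 1), up to a constant. So
-- in the strip the margin is free and `s` only has to leave enough room. In the row case the margin
-- must come from `s` itself: the upper half of a cut is open, which turns the strict bound into a
-- rational gap, hence into a power of q that beats any constant. The other obstacle is that q ^ s
-- is not a natural number and that comparisons of a rational with a cut cannot be decided. A
-- natural number comparable to q ^ s is found by locating `s` on a grid. Its constants have to be
-- uniform, since the size condition concerns every ring and not only the large ones.

-- Powers of naturals, and real exponents given by cuts

module Powers where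
  open import Data.Nat.Base
  open import Data.Nat.Properties
  open import Data.Nat.Tactic.RingSolver using (solve-∀)
  open import Data.Integer.Base as ℤ using (+_; -[1+_])
  import Data.Integer.Properties as ℤ
  open import Data.Nat.Coprimality using (Coprime)
  open import Data.Product.Base using (∃-syntax; ∃₂; _×_; _,_; proj₁; proj₂)
  open import Data.Sum.Base using (_⊎_; inj₁; inj₂)
  open import Data.Rational.Base as ℚ using (ℚ; mkℚ; 0ℚ; ↥_; ↧_; toℚᵘ)
  import Data.Rational.Properties as ℚ
  open import Data.Rational.Unnormalised.Base as ℚᵘ using (ℚᵘ; mkℚᵘ)
  import Data.Rational.Unnormalised.Properties as ℚᵘ
  open import Relation.Binary.PropositionalEquality using (_≡_; refl; sym; trans; cong; cong₂; subst; subst₂)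
  open import Relation.Nullary using (yes; no; contradiction)

  ^-cancelˡ-≤ : ∀ n .{{_ : NonZero n}} x y → x ^ n ≤ y ^ n → x ≤ y
  ^-cancelˡ-≤ n x y xⁿ≤yⁿ = ≮⇒≥ λ y<x → <⇒≱ (^-monoˡ-< n y<x) xⁿ≤yⁿ

  *-^-distrib : ∀ x y n → (x * y) ^ n ≡ x ^ n * y ^ n
  *-^-distrib x y zero    = refl
  *-^-distrib x y (suc n) =
    trans (cong (x * y *_) (*-^-distrib x y n)) (lemma x y (x ^ n) (y ^ n))
    where
    lemma : ∀ a b c d → a * b * (c * d) ≡ a * c * (b * d)
    lemma = solve-∀

  ^-^-comm : ∀ x m n → (x ^ m) ^ n ≡ (x ^ n) ^ m
  ^-^-comm x m n = trans (^-*-assoc x m n)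
    (trans (cong (x ^_) (*-comm m n)) (sym (^-*-assoc x n m)))

  n≤2^n : ∀ n → n ≤ 2 ^ n
  n≤2^n zero    = z≤n
  n≤2^n (suc n) = +-mono-≤ (m^n>0 2 n) (≤-trans (n≤2^n n) (m≤m+n (2 ^ n) 0))

  -- Induction on `X`: adding one to `X` raises the integer part of its n-th root by at most one.
  root : ∀ n .{{_ : NonZero n}} X → 1 ≤ X → ∃[ m ] 1 ≤ m × m ^ n ≤ X × X < suc m ^ n
  root n 1 _ = 1 , ≤-refl , ≤-reflexive (^-zeroˡ n)
    , subst (_< 2 ^ n) (^-zeroˡ n) (^-monoˡ-< n ≤-refl)
  root n (suc X@(suc _)) _ with root n X (s≤s z≤n)
  ... | m , 1≤m , mⁿ≤X , X<m′ⁿ with suc m ^ n ≤? suc X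
  ...   | yes m′ⁿ≤X′ = suc m , s≤s z≤n , m′ⁿ≤X′
                     , ≤-<-trans X<m′ⁿ (^-monoˡ-< n ≤-refl)
  ...   | no  m′ⁿ≰X′ = m , 1≤m , m≤n⇒m≤1+n mⁿ≤X , ≰⇒> m′ⁿ≰X′

  <⇒cross : ∀ (x : ℚ) {r i d} → toℚᵘ x ℚᵘ.≃ mkℚᵘ i d → r ℚ.< x →
            ↥ r ℤ.* + suc d ℤ.< i ℤ.* ↧ r
  <⇒cross x {mkℚ _ _ _} x≃ r<x = ℚᵘ.drop-*<* (ℚᵘ.<-respʳ-≃ x≃ (ℚ.toℚᵘ-mono-< r<x))

  >⇒cross : ∀ (x : ℚ) {r i d} → toℚᵘ x ℚᵘ.≃ mkℚᵘ i d → x ℚ.< r →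
            i ℤ.* ↧ r ℤ.< ↥ r ℤ.* + suc d
  >⇒cross x {mkℚ _ _ _} x≃ x<r = ℚᵘ.drop-*<* (ℚᵘ.<-respˡ-≃ x≃ (ℚ.toℚᵘ-mono-< x<r))

  /-≃ : ∀ i d → toℚᵘ (i ℚ./ suc d) ℚᵘ.≃ mkℚᵘ i d
  /-≃ i d = ℚ.toℚᵘ-fromℚᵘ (mkℚᵘ i d)

  /-mono-< : ∀ {a b} d → a < b → + a ℚ./ suc d ℚ.< + b ℚ./ suc d
  /-mono-< {a} {b} d a<b = ℚ.toℚᵘ-cancel-<
    (ℚᵘ.<-respˡ-≃ (ℚᵘ.≃-sym (/-≃ (+ a) d)) (ℚᵘ.<-respʳ-≃ (ℚᵘ.≃-sym (/-≃ (+ b) d))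
      (ℚᵘ.*<* (ℤ.*-monoʳ-<-pos (+ suc d) (ℤ.+<+ a<b)))))

  module Cut (s : ℝ) where
    open ℝ s

    upper-≤ : ∀ {p r} → p ℚ.≤ r → Upper p → Upper r
    upper-≤ {p} {r} p≤r Up with p ℚ.<? r
    ... | yes p<r = upper-closed p<r Up
    ... | no  p≮r = subst Upper (ℚ.≤-antisym p≤r (ℚ.≮⇒≥ p≮r)) Up

    lower<upper : ∀ {p r} → Lower p → Upper r → p ℚ.< r
    lower<upper Lp Ur = ℚ.≰⇒> λ r≤p → disjoint (Lp , upper-≤ r≤p Ur)

    module _ (0≤s : 0ℚ ≤ᵣ s) where

      upper-pos : ∀ {r} → Upper r → 0ℚ ℚ.< r
      upper-pos Ur = ℚ.≰⇒> λ r≤0 → 0≤s (upper-≤ r≤0 Ur)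

      upper-bounds : ∀ {r} → Upper r → ∀ X C b → X ≤ C · b ^ℝ s →
                     X ^ ℚ.↧ₙ r ≤ C ^ ℚ.↧ₙ r * b ^ ℤ.∣ ↥ r ∣
      upper-bounds {r@(mkℚ (+ u) v _)} Ur X C b X≤ =
        subst (_≤ C ^ suc v * b ^ u) (*-identityʳ (X ^ suc v)) (X≤ r Ur)
      upper-bounds {mkℚ -[1+ _ ] _ _} Ur _ _ _ _ with upper-pos Ur
      ... | ℚ.*<* ()

      -- The hypothesis on `X` speaks of `x` in lowest terms n / (e + 1), while thresholds such as 2
      -- (k + 1) / (k + 2) arrive unreduced. Since n (d + 1) = u (e + 1), raising to the power d + 1
      -- and cancelling the power e + 1 passes from one form to the other.
      bounded-by : ∀ {x u d} → toℚᵘ x ℚᵘ.≃ mkℚᵘ (+ u) d → Upper x →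
                   ∀ X C b → X ≤ C · b ^ℝ s → X ^ suc d ≤ C ^ suc d * b ^ u
      bounded-by {mkℚ -[1+ _ ] _ _} _ Ux _ _ _ _ with upper-pos Ux
      ... | ℚ.*<* ()
      bounded-by {x@(mkℚ (+ n) e _)} {u} {d} (ℚᵘ.*≡* nd≡ue) Ux X C b X≤ =
        ^-cancelˡ-≤ (suc e) (X ^ suc d) (C ^ suc d * b ^ u) (begin
          (X ^ suc d) ^ suc e                     ≡⟨ ^-^-comm X (suc d) (suc e) ⟩
          (X ^ suc e) ^ suc d                     ≤⟨ ^-monoˡ-≤ (suc d) (upper-bounds {x} Ux X C b X≤) ⟩
          (C ^ suc e * b ^ n) ^ suc d             ≡⟨ *-^-distrib (C ^ suc e) (b ^ n) (suc d) ⟩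
          (C ^ suc e) ^ suc d * (b ^ n) ^ suc d   ≡⟨ cong₂ _*_ (^-^-comm C (suc e) (suc d)) eq ⟩
          (C ^ suc d) ^ suc e * (b ^ u) ^ suc e   ≡⟨ *-^-distrib (C ^ suc d) (b ^ u) (suc e) ⟨
          (C ^ suc d * b ^ u) ^ suc e             ∎)
        where
        open ≤-Reasoning
        eq : (b ^ n) ^ suc d ≡ (b ^ u) ^ suc e
        eq = trans (^-*-assoc b n (suc d)) (trans
          (cong (b ^_) (ℤ.+-injective (trans (ℤ.pos-* n (suc d)) (trans nd≡ue (sym (ℤ.pos-* u (suc e)))))))
          (sym (^-*-assoc b u (suc e))))

      -- Upper cuts are open, so a strict bound s < a / d leaves room for a power saving.
      bounded-below : ∀ {x a d} → toℚᵘ x ℚᵘ.≃ mkℚᵘ (+ a) d → Upper x →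
                      ∃₂ λ u e → u * suc d < a * suc e ×
                        (∀ X C b → X ≤ C · b ^ℝ s → X ^ suc e ≤ C ^ suc e * b ^ u)
      bounded-below {x} {a} {d} x≃ Ux with upper-open Ux
      ... | r@(mkℚ -[1+ _ ] _ _) , _ , Ur with upper-pos Ur
      ...   | ℚ.*<* ()
      bounded-below {x} {a} {d} x≃ Ux | r@(mkℚ (+ u) e _) , r<x , Ur =
        u , e
        , ℤ.drop‿+<+ (subst₂ ℤ._<_ (sym (ℤ.pos-* u (suc d))) (sym (ℤ.pos-* a (suc e))) (<⇒cross x x≃ r<x))
        , upper-bounds {r} Ur

      private
        module Grid (n : ℕ) where
          [_] : ℕ → ℚ
          [ c ] = + c ℚ./ suc n

          -- The search places `s` only between (c - 1) / (n + 1) and (c + 1) / (n + 1), as its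
          -- position relative to the middle point cannot be decided. At c = 0 the lower bound is
          -- covered by 0 ≤ s.
          Previous : ℕ → Set
          Previous c = c ≡ 0 ⊎ ∃[ c′ ] c ≡ suc c′ × Lower [ c′ ]

          -- Locatedness at two neighbouring grid points either ends the search or supplies the
          -- `Lower` fact recorded for the next c. The fuel counts down to a grid point known to be
          -- upper, so running out of it contradicts `disjoint`.
          search : ∀ fuel c → Previous c → Upper [ c + fuel ] →
                   ∃[ c ] Previous c × Upper [ suc c ]
          search fuel c prev U with located (/-mono-< n (n<1+n c))
          ... | inj₂ U′ = c , prev , U′
          search zero c prev U | inj₁ L =
            contradiction (L , subst (λ m → Upper [ m ]) (+-identityʳ c) U) disjoint
          search (suc fuel) c prev U | inj₁ L =
            search fuel (suc c) (inj₂ (c , refl , L)) (subst (λ m → Upper [ m ]) (+-suc c fuel) U)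

          start : ∃[ c ] Upper [ c ]
          start with upper-inhabited
          ... | mkℚ -[1+ _ ] _ _ , Ur with upper-pos Ur
          ...   | ℚ.*<* ()
          -- An upper rational u / (e + 1) lies below the integer u + 1, which is the grid point
          -- with numerator (u + 1) (n + 1).
          start | r@(mkℚ (+ u) e _) , Ur = suc u * suc n ,
            upper-closed (ℚ.toℚᵘ-cancel-< (ℚᵘ.<-respʳ-≃ (ℚᵘ.≃-sym (/-≃ (+ (suc u * suc n)) n))
              (ℚᵘ.*<* (subst₂ ℤ._<_ (ℤ.pos-* u (suc n)) (ℤ.pos-* (suc u * suc n) (suc e)) (ℤ.+<+ ineq))))) Ur
            where
            ineq : u * suc n < suc u * suc n * suc e
            ineq = <-≤-trans (*-monoˡ-< (suc n) (n<1+n u)) (m≤m*n (suc u * suc n) (suc e))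

          point : ∃[ c ] Previous c × Upper [ suc c ]
          point = search (proj₁ start) 0 (inj₁ refl) (proj₂ start)

      -- The grid of multiples of 1/b is fine enough, as b ^ (1/b) ≤ 2.
      approximation : ∀ b .{{_ : NonZero b}} →
                      ∃[ m ] 1 ≤ m × (m ≤ 2 · b ^ℝ s) × (b ^ℝ s ≤ 4 · m)
      approximation b@(suc n) with Grid.point n
      -- `m` is the integer part of b ^ (c/b), so m ≤ b ^ (c/b) < m + 1 ≤ 2 m. As c/b is within 1/b
      -- of `s`, passing to b ^ s costs one more factor 2 on either side: hence the constants 2 and
      -- 4.
      ... | c , prev , U with root b (b ^ c) (m^n>0 b c)
      ...   | m , 1≤m , mᵇ≤ , <m′ᵇ = m , 1≤m , upper , lower
        where
        open Grid n
        open ≤-Reasoning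

        cv≤ub+v : ∀ {u e} .{cop : Coprime u (suc e)} → Upper (mkℚ (+ u) e cop) → Previous c → c * suc e ≤ u * b + suc e
        cv≤ub+v _ (inj₁ refl) = z≤n
        cv≤ub+v {u} {e} Ur (inj₂ (c′ , refl , L)) = begin
          suc e + c′ * suc e ≤⟨ +-monoʳ-≤ (suc e) (<⇒≤ (ℤ.drop‿+<+ (subst₂ ℤ._<_
                                  (sym (ℤ.pos-* c′ (suc e))) (sym (ℤ.pos-* u b))
                                  (>⇒cross [ c′ ] (/-≃ (+ c′) n) (lower<upper L Ur))))) ⟩
          suc e + u * b      ≡⟨ +-comm (suc e) (u * b) ⟩
          u * b + suc e      ∎

        upper : m ≤ 2 · b ^ℝ s
        upper (mkℚ -[1+ _ ] _ _) Ur with upper-pos Ur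
        ... | ℚ.*<* ()
        upper (mkℚ (+ u) e _) Ur = ≤-trans (≤-reflexive (*-identityʳ (m ^ suc e))) (^-cancelˡ-≤ b (m ^ suc e) (2 ^ suc e * b ^ u) (begin
          (m ^ suc e) ^ b               ≡⟨ ^-^-comm m (suc e) b ⟩
          (m ^ b) ^ suc e               ≤⟨ ^-monoˡ-≤ (suc e) mᵇ≤ ⟩
          (b ^ c) ^ suc e               ≡⟨ ^-*-assoc b c (suc e) ⟩
          b ^ (c * suc e)               ≤⟨ ^-monoʳ-≤ b (cv≤ub+v Ur prev) ⟩
          b ^ (u * b + suc e)           ≡⟨ ^-distribˡ-+-* b (u * b) (suc e) ⟩
          b ^ (u * b) * b ^ suc e       ≤⟨ *-monoʳ-≤ (b ^ (u * b)) (^-monoˡ-≤ (suc e) (n≤2^n b)) ⟩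
          b ^ (u * b) * (2 ^ b) ^ suc e ≡⟨ *-comm (b ^ (u * b)) _ ⟩
          (2 ^ b) ^ suc e * b ^ (u * b) ≡⟨ cong₂ _*_ (^-^-comm 2 b (suc e)) (sym (^-*-assoc b u b)) ⟩
          (2 ^ suc e) ^ b * (b ^ u) ^ b ≡⟨ *-^-distrib (2 ^ suc e) (b ^ u) b ⟨
          (2 ^ suc e * b ^ u) ^ b       ∎))

        m′≤2m : suc m ≤ 2 * m
        m′≤2m = ≤-trans (+-monoˡ-≤ m 1≤m) (+-monoʳ-≤ m (m≤m+n m 0))

        4m≡ : ∀ m → 2 * (2 * m) ≡ 4 * m
        4m≡ = solve-∀

        lower : b ^ℝ s ≤ 4 · m
        lower (mkℚ -[1+ u ] e _) _ = *-mono-≤ (m^n>0 (4 * m) {{4m≢0}} (suc e)) (m^n>0 b (suc u))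
          where
          4m≢0 : NonZero (4 * m)
          4m≢0 = >-nonZero {4 * m} (≤-trans 1≤m (m≤n*m m 4))
        lower r@(mkℚ (+ u) e _) Lr = ≤-trans (^-cancelˡ-≤ b (b ^ u) ((4 * m) ^ suc e) (begin
          (b ^ u) ^ b                       ≡⟨ ^-*-assoc b u b ⟩
          b ^ (u * b)                       ≤⟨ ^-monoʳ-≤ b (<⇒≤ (ℤ.drop‿+<+ (subst₂ ℤ._<_
                                                 (sym (ℤ.pos-* u b)) (sym (ℤ.pos-* (suc c) (suc e)))
                                                 (<⇒cross [ suc c ] (/-≃ (+ suc c) n) (lower<upper Lr U))))) ⟩
          b ^ (suc e + c * suc e)           ≡⟨ ^-distribˡ-+-* b (suc e) (c * suc e) ⟩
          b ^ suc e * b ^ (c * suc e)       ≡⟨ cong (b ^ suc e *_) (^-*-assoc b c (suc e)) ⟨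
          b ^ suc e * (b ^ c) ^ suc e       ≤⟨ *-mono-≤ (^-monoˡ-≤ (suc e) (n≤2^n b))
                                                 (^-monoˡ-≤ (suc e) (≤-trans (<⇒≤ <m′ᵇ) (^-monoˡ-≤ b m′≤2m))) ⟩
          (2 ^ b) ^ suc e * ((2 * m) ^ b) ^ suc e ≡⟨ *-^-distrib (2 ^ b) ((2 * m) ^ b) (suc e) ⟨
          (2 ^ b * (2 * m) ^ b) ^ suc e     ≡⟨ cong (_^ suc e) (*-^-distrib 2 (2 * m) b) ⟨
          ((2 * (2 * m)) ^ b) ^ suc e       ≡⟨ ^-^-comm (2 * (2 * m)) b (suc e) ⟩
          ((2 * (2 * m)) ^ suc e) ^ b       ≡⟨ cong (λ x → (x ^ suc e) ^ b) (4m≡ m) ⟩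
          ((4 * m) ^ suc e) ^ b             ∎)) (≤-reflexive (sym (*-identityʳ ((4 * m) ^ suc e))))

  ≤^ℝ-mono : ∀ {X Y C D b} s → X ≤ Y → C ≤ D → Y ≤ C · b ^ℝ s → X ≤ D · b ^ℝ s
  ≤^ℝ-mono {b = b} s X≤Y C≤D Y≤ r Ur = ≤-trans (*-monoˡ-≤ (b ^ neg (↥ r)) (^-monoˡ-≤ (ℚ.↧ₙ r) X≤Y))
    (≤-trans (Y≤ r Ur) (*-monoˡ-≤ (b ^ pos (↥ r)) (^-monoˡ-≤ (ℚ.↧ₙ r) C≤D)))

  ^ℝ≤-mono : ∀ {X Y b} s C D → X ≤ D * Y → b ^ℝ s ≤ C · X → b ^ℝ s ≤ (C * D) · Y
  ^ℝ≤-mono {X} {Y} {b} s C D X≤ ≤X r Lr =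
    ≤-trans (≤X r Lr) (*-monoˡ-≤ (b ^ neg (↥ r)) (^-monoˡ-≤ (ℚ.↧ₙ r)
      (≤-trans (*-monoʳ-≤ C X≤) (≤-reflexive (sym (*-assoc C D Y))))))

-- Sizes of finite setoids and of quotients

module Counting where
  open import Algebra.Bundles using (CommutativeRing)
  open import Data.Fin.Base using (Fin; zero; suc; combine; quotient; remainder; funToFin; finToFun)
  import Data.Fin.Properties as Fin
  open import Data.Nat.Base
  open import Data.Nat.Properties
  open import Data.Product.Base using (∃-syntax; _×_; _,_; proj₁; proj₂)
  open import Function.Bundles using (module Inverse)
  open import Level using (0ℓ)
  open import Relation.Binary.Bundles using (Setoid)
  open import Relation.Binary.PropositionalEquality as ≡ using (_≡_; cong)
  open import Relation.Nullary using (Dec; yes; no; contradiction)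
  import Relation.Nullary.Decidable as Dec

  module Size {a ℓ} (S : Setoid a ℓ) where
    open Setoid S renaming (Carrier to A)

    Injective : ∀ {n} → (Fin n → A) → Set ℓ
    Injective e = ∀ {i j} → e i ≈ e j → i ≡ j

    Surjective : ∀ {n} → (Fin n → A) → Set _
    Surjective e = ∀ x → ∃[ i ] x ≈ e i

    hasSize : ∀ {n} (e : Fin n → A) → Injective e → Surjective e → S HasSize n
    hasSize e inj surj = record
      { to        = e
      ; from      = λ x → proj₁ (surj x)
      ; to-cong   = λ { ≡.refl → refl }
      ; from-cong = λ {x} {y} x≈y →
          inj (trans (sym (proj₂ (surj x))) (trans x≈y (proj₂ (surj y))))
      ; inverse   = (λ {x} i≡ → trans (reflexive (cong e i≡)) (sym (proj₂ (surj x))))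
                  , (λ {i} {y} y≈ → inj (trans (sym (proj₂ (surj y))) y≈))
      }

    module _ {n} (size : S HasSize n) where
      open Inverse size

      to-injective : Injective to
      to-injective {i} {j} eq =
        ≡.trans (≡.sym (inverseʳ {i} (refl))) (inverseʳ {j} eq)

      to-surjective : Surjective to
      to-surjective x = from x , sym (inverseˡ ≡.refl)

      from-injective : ∀ {x y} → from x ≡ from y → x ≈ y
      from-injective {x} {y} eq =
        trans (proj₂ (to-surjective x)) (trans (to-cong eq) (sym (proj₂ (to-surjective y))))

      finite-dec : ∀ x y → Dec (x ≈ y)
      finite-dec x y = Dec.map′ from-injective from-cong (from x Fin.≟ from y)

      -- Since `f` is precomposed with the enumeration `to`, it need not respect the equality of the
      -- setoid. A code may therefore depend on how a configuration is presented; only equal codes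
      -- have to imply equivalence.
      size-≤ : ∀ {N} (f : A → Fin N) → (∀ {x y} → f x ≡ f y → x ≈ y) → n ≤ N
      size-≤ f inj = Fin.injective⇒≤ {f = λ i → f (to i)} λ eq → to-injective (inj eq)

      ≤-size : ∀ {N} (e : Fin N → A) → Injective e → N ≤ n
      ≤-size e inj = Fin.injective⇒≤ {f = λ i → from (e i)} λ eq → inj (from-injective eq)

    -- Greedily choose one representative of each class met by g.
    representatives : (∀ x y → Dec (x ≈ y)) → ∀ {N} (g : Fin N → A) →
      ∃[ n ] ∃[ e ] Injective {n} e × (∀ i → ∃[ j ] g i ≈ e j)
    representatives _≟_ {zero} g = 0 , (λ ()) , (λ { {()} }) , λ ()
    representatives _≟_ {suc N} g with representatives _≟_ (λ i → g (suc i))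
    ... | n , e , inj , cover with Fin.any? (λ j → g zero ≟ e j)
    ...   | yes old = n , e , inj , λ { zero → old ; (suc i) → cover i }
    ...   | no  new = suc n , e′ , inj′ , λ { zero → zero , refl
                                            ; (suc i) → suc (proj₁ (cover i)) , proj₂ (cover i) }
      where
      e′ : Fin (suc n) → A
      e′ zero    = g zero
      e′ (suc j) = e j

      inj′ : Injective e′
      inj′ {zero}  {zero}  _  = ≡.refl
      inj′ {zero}  {suc j} eq = contradiction (j , eq) new
      inj′ {suc i} {zero}  eq = contradiction (i , sym eq) new
      inj′ {suc i} {suc j} eq = cong suc (inj eq)

    quotient-size : (∀ x y → Dec (x ≈ y)) → ∀ {N} (g : Fin N → A) → Surjective g →
                    ∃[ n ] S HasSize n
    quotient-size _≟_ g surj with representatives _≟_ g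
    ... | n , e , inj , cover = n , hasSize e inj λ x →
      let i , x≈ = surj x ; j , ≈e = cover i in j , trans x≈ ≈e

  funToFin-injective : ∀ {m n} (f g : Fin m → Fin n) → funToFin f ≡ funToFin g → ∀ i → f i ≡ g i
  funToFin-injective f g eq i =
    ≡.trans (≡.sym (Fin.finToFun-funToFin f i))
      (≡.trans (cong (λ c → finToFun c i) eq) (Fin.finToFun-funToFin g i))

  finToFun-injective : ∀ {m n} {c d : Fin (m ^ n)} →
                       (∀ i → finToFun {m} {n} c i ≡ finToFun d i) → c ≡ d
  finToFun-injective {m} {n} {c} {d} eq =
    ≡.trans (≡.sym (Fin.funToFin-finToFin {n} {m} c))
      (≡.trans (funToFin-cong n eq) (Fin.funToFin-finToFin {n} {m} d))
    where
    funToFin-cong : ∀ n {f g : Fin n → Fin m} → (∀ i → f i ≡ g i) → funToFin f ≡ funToFin g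
    funToFin-cong zero    _   = ≡.refl
    funToFin-cong (suc n) f≡g = ≡.cong₂ combine (f≡g zero) (funToFin-cong n (λ i → f≡g (suc i)))

  remQuot-injective : ∀ {m} n {i j : Fin (m * n)} → quotient {m} n i ≡ quotient n j →
                      remainder {m} n i ≡ remainder {m} n j → i ≡ j
  remQuot-injective {m} n {i} {j} eq₁ eq₂ = ≡.trans (≡.sym (Fin.combine-remQuot {m} n i))
    (≡.trans (≡.cong₂ combine eq₁ eq₂) (Fin.combine-remQuot {m} n j))

  module FinitePlane (R : CommutativeRing 0ℓ 0ℓ) where
    open CommutativeRing R using (Carrier; _≈_; setoid)
    open Plane R using (Point; R²; Configuration; _∙_; _⊥)
    open Setoid Point using () renaming (_≈_ to _≋_; trans to ≋-trans; sym to ≋-sym; refl to ≋-refl)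

    -- Membership carries an index as data, so the row or the residue of a point can later be read
    -- off from its membership proof.
    image : ∀ {m} → (Fin m → R²) → Subset R
    image e = record
      { _∋_      = λ x → ∃[ i ] x ≋ e i
      ; respects = λ { x≋y (i , x≋e) → i , ≋-trans (≋-sym x≋y) x≋e }
      }

    image-size : ∀ {m} (e : Fin m → R²) → (∀ {i j} → e i ≋ e j → i ≡ j) →
                 ⟦ R ∣ image e ⟧ HasSize m
    image-size e inj = Size.hasSize ⟦ R ∣ image e ⟧ (λ i → e i , i , ≋-refl) inj proj₂

    full-size : ∀ {q} → setoid HasSize q → ⟦ R ∣ full R ⟧ HasSize (q * q)
    full-size {q} size = Size.hasSize ⟦ R ∣ full R ⟧
      (λ i → (to (quotient {q} q i) , to (remainder {q} q i)) , _)
      (λ (eq₁ , eq₂) → remQuot-injective {q} q (to-injective size eq₁) (to-injective size eq₂))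
      λ ((x , y) , _) → let i , x≈ = to-surjective size x ; j , y≈ = to-surjective size y in
        combine i j , trans x≈ (reflexive (cong (λ c → to (proj₁ c)) (≡.sym (Fin.remQuot-combine {q} i j))))
                    , trans y≈ (reflexive (cong (λ c → to (proj₂ c)) (≡.sym (Fin.remQuot-combine {q} i j))))
      where
      open CommutativeRing R using (trans; reflexive)
      open Size setoid
      open Inverse size using (to)

    ∼-resp : ∀ {n} (x y : Fin n → R²) → (∀ i → x i ≋ y i) → ∀ i j → x i ∙ x j ⊥ ≈ y i ∙ y j ⊥
    ∼-resp x y x≋y i j = +-cong (*-cong (proj₁ (x≋y i)) (proj₂ (x≋y j)))
                                (*-cong (proj₂ (x≋y i)) (-‿cong (proj₁ (x≋y j))))
      where open CommutativeRing R using (+-cong; *-cong; -‿cong)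

    -- Finiteness of the ring makes its equality decidable, hence also the equivalence of
    -- configurations, which consists of finitely many equations. The m ^ n tuples of listed points
    -- then meet every class.
    𝒞-size : ∀ {q m} → setoid HasSize q → ∀ n E → ⟦ R ∣ E ⟧ HasSize m → ∃[ c ] 𝒞 R n E HasSize c
    𝒞-size {q} {m} size n E sizeE = Size.quotient-size (𝒞 R n E)
      (λ x y → Fin.all? λ i → Fin.all? λ j → Size.finite-dec setoid size _ _)
      {m ^ n} (λ c i → to (finToFun c i))
      λ x → funToFin (λ i → from (x i)) , ∼-resp (λ i → proj₁ (x i)) _ λ i →
        Setoid.trans ⟦ R ∣ E ⟧ {x i} {to (from (x i))} {to (finToFun (funToFin (λ i → from (x i))) i)} (proj₂ (Size.to-surjective ⟦ R ∣ E ⟧ sizeE (x i)))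
          (Setoid.reflexive ⟦ R ∣ E ⟧ (cong to (≡.sym (Fin.finToFun-funToFin (λ i → from (x i)) i))))
      where open Inverse sizeE

-- Determinants and the action of SL₂

module Classes where
  open Counting
  open import Algebra.Bundles using (CommutativeRing; module Semiring)
  import Algebra.Definitions.RawSemiring as RawSemiring
  import Algebra.Properties.Ring as RingProperties
  import Algebra.Solver.Ring.NaturalCoefficients.Default as Solver
  open import Data.Fin.Base using (Fin; zero; suc; toℕ; combine; quotient; remainder; funToFin; finToFun; inject≤; punchIn; punchOut)
  import Data.Fin.Properties as Fin
  open import Data.Nat.Base hiding (_+_; _*_; _^_)
  import Data.Nat.Base as ℕ
  open import Data.Product.Base using (∃-syntax; ∃₂; _×_; _,_; proj₁; proj₂)
  open import Data.Sum.Base using (_⊎_; inj₁; inj₂; map₂)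
  open import Function.Bundles using (module Inverse)
  open import Level using (0ℓ)
  open import Relation.Binary.Bundles using (Setoid)
  open import Relation.Binary.PropositionalEquality as ≡ using (_≡_; cong)
  import Relation.Binary.Reasoning.Setoid as SetoidReasoning
  open import Relation.Nullary using (yes; no)

  any-or-all : ∀ {n p q} {P : Fin n → Set p} {Q : Fin n → Set q} →
               (∀ i → P i ⊎ Q i) → (∃[ i ] P i) ⊎ (∀ i → Q i)
  any-or-all {zero}  _ = inj₂ λ ()
  any-or-all {suc n} f with f zero | any-or-all (λ i → f (suc i))
  ... | inj₁ p | _            = inj₁ (zero , p)
  ... | inj₂ _ | inj₁ (i , p) = inj₁ (suc i , p)
  ... | inj₂ q | inj₂ qs      = inj₂ λ { zero → q ; (suc i) → qs i }

  module Determinants (R : CommutativeRing 0ℓ 0ℓ) where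
    open CommutativeRing R
    open Plane R using (R²; _∙_; _⊥)
    open RingProperties ring using (-‿distribʳ-*)
    open SetoidReasoning setoid
    open Solver commutativeSemiring using (solve; _:=_; _:+_; _:*_; con)

    cross⇒≈ : ∀ a b c d → a + d ≈ c + b → a - b ≈ c - d
    cross⇒≈ a b c d eq = begin
      a - b             ≈⟨ +-identityʳ _ ⟨
      a - b + 0#        ≈⟨ +-congˡ (-‿inverseʳ d) ⟨
      a - b + (d - d)   ≈⟨ solve 4 (λ a b d e → (a :+ b) :+ (d :+ e) := (a :+ d) :+ (b :+ e)) refl a (- b) d (- d) ⟩
      a + d + (- b - d) ≈⟨ +-congʳ eq ⟩
      c + b + (- b - d) ≈⟨ solve 4 (λ c b e d → (c :+ b) :+ (e :+ d) := (c :+ d) :+ (b :+ e)) refl c b (- b) (- d) ⟩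
      c - d + (b - b)   ≈⟨ +-congˡ (-‿inverseʳ b) ⟩
      c - d + 0#        ≈⟨ +-identityʳ _ ⟩
      c - d             ∎

    -- With the subtracted terms moved across, an equality of determinants becomes a
    -- subtraction-free identity, which holds in any commutative semiring and suits the solver.
    det-≈ : ∀ x₁ x₂ y₁ y₂ z₁ z₂ w₁ w₂ →
            x₁ * y₂ + z₂ * w₁ ≈ z₁ * w₂ + x₂ * y₁ →
            (x₁ , x₂) ∙ (y₁ , y₂) ⊥ ≈ (z₁ , z₂) ∙ (w₁ , w₂) ⊥
    det-≈ x₁ x₂ y₁ y₂ z₁ z₂ w₁ w₂ eq = begin
      x₁ * y₂ + x₂ * - y₁ ≈⟨ +-congˡ (-‿distribʳ-* x₂ y₁) ⟨
      x₁ * y₂ - x₂ * y₁   ≈⟨ cross⇒≈ _ _ _ _ eq ⟩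
      z₁ * w₂ - z₂ * w₁   ≈⟨ +-congˡ (-‿distribʳ-* z₂ w₁) ⟩
      z₁ * w₂ + z₂ * - w₁ ∎

    linear : (a b c d : Carrier) → R² → R²
    linear a b c d (x₁ , x₂) = a * x₁ + b * x₂ , c * x₁ + d * x₂

    det-linear : ∀ a b c d → a * d ≈ 1# + b * c → ∀ x y →
                 linear a b c d x ∙ linear a b c d y ⊥ ≈ x ∙ y ⊥
    det-linear a b c d ad≈1+bc (x₁ , x₂) (y₁ , y₂) = det-≈ _ _ _ _ _ _ _ _ (begin
      (a * x₁ + b * x₂) * (c * y₁ + d * y₂) + x₂ * y₁
        ≈⟨ solve 8 (λ a b c d x₁ x₂ y₁ y₂ →
             (a :* x₁ :+ b :* x₂) :* (c :* y₁ :+ d :* y₂) :+ x₂ :* y₁ :=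
             a :* c :* x₁ :* y₁ :+ b :* d :* x₂ :* y₂ :+ (a :* d :* (x₁ :* y₂) :+ (con 1 :+ b :* c) :* (x₂ :* y₁)))
             refl a b c d x₁ x₂ y₁ y₂ ⟩
      a * c * x₁ * y₁ + b * d * x₂ * y₂ + (a * d * (x₁ * y₂) + (1# + b * c) * (x₂ * y₁))
        -- The determinant condition is used in opposite directions on the two mixed terms, so that
        -- their coefficients trade places and everything else cancels.
        ≈⟨ +-congˡ (+-cong (*-congʳ ad≈1+bc) (*-congʳ (sym ad≈1+bc))) ⟩
      a * c * x₁ * y₁ + b * d * x₂ * y₂ + ((1# + b * c) * (x₁ * y₂) + a * d * (x₂ * y₁))
        ≈⟨ solve 8 (λ a b c d x₁ x₂ y₁ y₂ →
             a :* c :* x₁ :* y₁ :+ b :* d :* x₂ :* y₂ :+ ((con 1 :+ b :* c) :* (x₁ :* y₂) :+ a :* d :* (x₂ :* y₁)) :=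
             x₁ :* y₂ :+ (c :* x₁ :+ d :* x₂) :* (a :* y₁ :+ b :* y₂))
             refl a b c d x₁ x₂ y₁ y₂ ⟩
      x₁ * y₂ + (c * x₁ + d * x₂) * (a * y₁ + b * y₂) ∎)

  -- The common ground of fields and ℤ/p^ℓ for the row construction. The listed units need not be
  -- all of them: half of the ring suffices, at the cost of constant factors.
  record Units (R : CommutativeRing 0ℓ 0ℓ) (q : ℕ) : Set₁ where
    open CommutativeRing R
    field
      size           : setoid HasSize q
      φ              : ℕ
      unit inv       : Fin φ → Carrier
      unit-injective : ∀ {i j} → unit i ≈ unit j → i ≡ j
      unit-inv       : ∀ i → unit i * inv i ≈ 1#
      q≤2φ           : q ≤ 2 ℕ.* φ

  -- Sets made of full rows, and the classes of the whole plane

  module Rows {R : CommutativeRing 0ℓ 0ℓ} {q : ℕ} (U : Units R q) where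
    open Units U
    open CommutativeRing R hiding (zero) renaming (Carrier to A)
    open Plane R using (R²; Point; Configuration; _∙_; _⊥)
    open Setoid Point using () renaming (_≈_ to _≋_)
    open FinitePlane R
    open Determinants R
    open Size setoid
    open Inverse size using (to; from; to-cong)
    open SetoidReasoning setoid
    open Solver commutativeSemiring using (solve; _:=_; _:+_; _:*_; con)
    open RingProperties ring using (-‿distribˡ-*; -0#≈0#)

    axis : ∀ {m} → m ≤ q → Fin m → R²
    axis m≤q i = to (inject≤ i m≤q) , 0#

    axis-injective : ∀ {m} (m≤q : m ≤ q) {i j} → axis m≤q i ≋ axis m≤q j → i ≡ j
    axis-injective m≤q (eq , _) = Fin.inject≤-injective m≤q m≤q _ _ (to-injective size eq)

    axis-classes : ∀ {m} (m≤q : m ≤ q) n {c} → 𝒞 R n (image (axis m≤q)) HasSize c → c ≤ 1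
    axis-classes m≤q n sizeC = Size.size-≤ (𝒞 R n (image (axis m≤q))) sizeC {1} (λ _ → zero) λ {x} {y} _ i j →
      trans (zero-det (x i) (x j)) (sym (zero-det (y i) (y j)))
      where
      zero-det : (x y : Setoid.Carrier ⟦ R ∣ image (axis m≤q) ⟧) → proj₁ x ∙ proj₁ y ⊥ ≈ 0#
      zero-det ((x₁ , x₂) , _ , _ , x₂≈0) ((y₁ , y₂) , _ , _ , y₂≈0) = begin
        x₁ * y₂ + x₂ * - y₁ ≈⟨ +-cong (*-congˡ y₂≈0) (*-congʳ x₂≈0) ⟩
        x₁ * 0# + 0# * - y₁ ≈⟨ +-cong (zeroʳ x₁) (zeroˡ (- y₁)) ⟩
        0# + 0#             ≈⟨ +-identityʳ 0# ⟩
        0#                  ∎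

    module _ {a} (a≤φ : a ≤ φ) where

      rows : Fin (a ℕ.* q) → R²
      rows i = to (remainder {a} q i) , unit (inject≤ (quotient {a} q i) a≤φ)

      rows-injective : ∀ {i j} → rows i ≋ rows j → i ≡ j
      rows-injective {i} {j} (eq₁ , eq₂) = remQuot-injective {a} q
        (Fin.inject≤-injective a≤φ a≤φ _ _ (unit-injective eq₂)) (to-injective size eq₁)

      -- The shear fixing every row and moving the zeroth point onto the axis
      -- x₁ = 0 normalises a configuration.
      rows-classes : ∀ k {c} → 𝒞 R (suc k) (image rows) HasSize c →
                     c ≤ a ℕ.^ suc k ℕ.* q ℕ.^ k
      rows-classes k sizeC = Size.size-≤ (𝒞 R (suc k) (image rows)) sizeC code λ {x} {y} eq i j →
        trans (sym (det-linear _ _ _ _ (shear-det (slope x)) _ _))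
          (trans (∼-resp (normal x) (normal y) (code⇒normal x y eq) i j)
                 (det-linear _ _ _ _ (shear-det (slope y)) _ _))
        where
        Config = Configuration (suc k) (image rows)

        shear-det : ∀ t → 1# * 1# ≈ 1# + t * 0#
        shear-det = solve 1 (λ t → con 1 :* con 1 := con 1 :+ t :* con 0) refl

        row : Config → Fin (suc k) → Fin a
        row x i = quotient {a} q (proj₁ (proj₂ (x i)))

        slope : Config → A
        slope x = - (proj₁ (proj₁ (x zero)) * inv (inject≤ (row x zero) a≤φ))

        normal : Config → Fin (suc k) → R²
        normal x i = linear 1# (slope x) 0# 1# (proj₁ (x i))

        normal-zero : ∀ x → proj₁ (normal x zero) ≈ 0#
        normal-zero x with x zero
        ... | (x₁ , x₂) , i , _ , x₂≈ = begin
          1# * x₁ + - (x₁ * v) * x₂ ≈⟨ +-cong (*-identityˡ x₁) (*-congˡ x₂≈) ⟩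
          x₁ + - (x₁ * v) * u       ≈⟨ +-congˡ (-‿distribˡ-* (x₁ * v) u) ⟨
          x₁ - x₁ * v * u           ≈⟨ +-congˡ (-‿cong (trans (*-assoc x₁ v u)
                                         (trans (*-congˡ (trans (*-comm v u) (unit-inv _))) (*-identityʳ x₁)))) ⟩
          x₁ - x₁                   ≈⟨ -‿inverseʳ x₁ ⟩
          0#                        ∎
          where
          u v : A
          u = unit (inject≤ (quotient {a} q i) a≤φ)
          v = inv (inject≤ (quotient {a} q i) a≤φ)

        normal-row : ∀ x i → proj₂ (normal x i) ≈ unit (inject≤ (row x i) a≤φ)
        normal-row x i with x i
        ... | (x₁ , x₂) , _ , _ , x₂≈ =
          trans (solve 2 (λ x₁ x₂ → con 0 :* x₁ :+ con 1 :* x₂ := x₂) refl x₁ x₂) x₂≈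

        code : Config → Fin (a ℕ.^ suc k ℕ.* q ℕ.^ k)
        code x = combine (funToFin (row x)) (funToFin λ i → from (proj₁ (normal x (suc i))))

        code⇒normal : ∀ x y → code x ≡ code y → ∀ i → normal x i ≋ normal y i
        code⇒normal x y eq i =
          first i , trans (normal-row x i) (trans (reflexive (cong (λ r → unit (inject≤ r a≤φ))
            (funToFin-injective (row x) (row y) rows≡ i))) (sym (normal-row y i)))
          where
          rows≡ = Fin.combine-injectiveˡ (funToFin (row x)) _ (funToFin (row y)) _ eq
          rest≡ = Fin.combine-injectiveʳ (funToFin (row x)) _ (funToFin (row y)) _ eq
          first : ∀ i → proj₁ (normal x i) ≈ proj₁ (normal y i)
          first zero    = trans (normal-zero x) (sym (normal-zero y))
          first (suc i) = from-injective size (funToFin-injective _ (λ i → from (proj₁ (normal y (suc i)))) rest≡ i)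

    -- The determinant against (1 , 0) reads off a second coordinate, in particular the unit u of
    -- the point (0 , u). The determinant against (0 , u) is u times a first coordinate, and u is by
    -- then known and invertible.
    full-classes : ∀ k {n} → 𝒞 R (2 ℕ.+ k) (full R) HasSize n → φ ℕ.* (q ℕ.* q) ℕ.^ k ≤ n
    full-classes k sizeC = Size.≤-size (𝒞 R (2 ℕ.+ k) (full R)) sizeC config config-injective
      where
      N = (q ℕ.* q) ℕ.^ k

      height : Fin (φ ℕ.* N) → Fin φ
      height = quotient {φ} N

      other : Fin (φ ℕ.* N) → Fin k → Fin (q ℕ.* q)
      other c = finToFun (remainder {φ} N c)

      open Inverse (full-size size) using () renaming (to to point)

      config : Fin (φ ℕ.* N) → Configuration (2 ℕ.+ k) (full R)
      config c zero          = (1# , 0#) , _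
      config c (suc zero)    = (0# , unit (height c)) , _
      config c (suc (suc i)) = point (other c i)

      det-zero : ∀ x₁ x₂ → (1# , 0#) ∙ (x₁ , x₂) ⊥ ≈ x₂
      det-zero x₁ x₂ = solve 2 (λ x m → con 1 :* x :+ con 0 :* m := x) refl x₂ (- x₁)

      det-one : ∀ i x₁ x₂ → (x₁ , x₂) ∙ (0# , unit i) ⊥ * inv i ≈ x₁
      det-one i x₁ x₂ = begin
        (x₁ * unit i + x₂ * - 0#) * inv i ≈⟨ *-congʳ (+-congˡ (*-congˡ -0#≈0#)) ⟩
        (x₁ * unit i + x₂ * 0#) * inv i   ≈⟨ solve 4 (λ x y u v → (x :* u :+ y :* con 0) :* v := x :* (u :* v))
                                               refl x₁ x₂ (unit i) (inv i) ⟩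
        x₁ * (unit i * inv i)             ≈⟨ *-congˡ (unit-inv i) ⟩
        x₁ * 1#                           ≈⟨ *-identityʳ x₁ ⟩
        x₁                                ∎

      config-injective : ∀ {c d} → Setoid._≈_ (𝒞 R (2 ℕ.+ k) (full R)) (config c) (config d) → c ≡ d
      config-injective {c} {d} eq =
        remQuot-injective {φ} N heights≡ (finToFun-injective {q ℕ.* q} {k} others≡)
        where
        heights≡ : height c ≡ height d
        heights≡ = unit-injective (trans (sym (det-zero 0# _)) (trans (eq zero (suc zero)) (det-zero 0# _)))

        others≡ : ∀ i → other c i ≡ other d i
        others≡ i = Size.to-injective ⟦ R ∣ full R ⟧ (full-size size)
          ( trans (sym (det-one (height c) _ _))
              (trans (*-cong (eq (suc (suc i)) (suc zero)) (reflexive (cong inv heights≡)))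
                     (det-one (height d) _ _))
          , trans (sym (det-zero _ _)) (trans (eq zero (suc (suc i))) (det-zero _ _)))


  -- Modelled on ℤ/p^(l + 1) with π = p and Q = p ^ l. The maps `residue` and `representative`
  -- express that π x depends only on x modulo p ^ l and takes Q different values, without any
  -- division by π.
  record Local (R : CommutativeRing 0ℓ 0ℓ) (q l Q : ℕ) : Set₁ where
    open CommutativeRing R
    open RawSemiring (Semiring.rawSemiring semiring) using (_^_)
    field
      units           : Units R q
      π               : Carrier
      nilpotent       : π ^ suc l ≈ 0#
      unit-or-π       : ∀ x → (∃[ y ] x * y ≈ 1#) ⊎ (∃[ y ] x ≈ π * y)
      residue         : Carrier → Fin Q
      residue-≈       : ∀ {x y} → residue x ≡ residue y → π * x ≈ π * y
      representative  : Fin Q → Carrier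
      representative-injective : ∀ {i j} → π * representative i ≈ π * representative j → i ≡ j

  -- Configurations in the strip of points (unit , π c)

  module Strip {R : CommutativeRing 0ℓ 0ℓ} {q l Q : ℕ} (L : Local R q l Q) where
    open Local L
    open Units units
    open CommutativeRing R hiding (zero) renaming (Carrier to A)
    open RawSemiring (Semiring.rawSemiring semiring) using (_^_)
    open Plane R using (R²; Point; Configuration; _∙_; _⊥)
    open Setoid Point using () renaming (_≈_ to _≋_)
    open FinitePlane R
    open Determinants R
    open SetoidReasoning setoid
    open Solver commutativeSemiring using (solve; _:=_; _:+_; _:*_; con)
    open RingProperties ring using (-‿distribˡ-*; -‿distribʳ-*)

    -- Powers of π common to all entries are extracted until some entry is a unit or the fuel is
    -- spent. The fuel will be l: together with the factor π that the strip itself provides,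
    -- spending it yields π ^ (l + 1) = 0.
    factor : ∀ f {k} (d : Fin k → A) →
             ∃₂ λ (w : Fin (suc f)) (d′ : Fin k → A) → (∀ i → d i ≈ π ^ toℕ w * d′ i) ×
               ((∃₂ λ i y → d′ i * y ≈ 1#) ⊎ toℕ w ≡ f)
    factor zero d = zero , d , (λ i → sym (*-identityˡ (d i))) , inj₂ ≡.refl
    factor (suc f) d with any-or-all (λ i → unit-or-π (d i))
    ... | inj₁ u = zero , d , (λ i → sym (*-identityˡ (d i))) , inj₁ u
    ... | inj₂ ds with factor f (λ i → proj₁ (ds i))
    ...   | w , d′ , d≈ , end = suc w , d′ , (λ i → begin
            d i                        ≈⟨ proj₂ (ds i) ⟩
            π * proj₁ (ds i)           ≈⟨ *-congˡ (d≈ i) ⟩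
            π * (π ^ toℕ w * d′ i)     ≈⟨ *-assoc π _ (d′ i) ⟨
            π * π ^ toℕ w * d′ i       ∎) , map₂ (cong suc) end

    -- In a configuration normalised by SL₂ the zeroth point is (1 , 0) and the
    -- others are (x i , π ^ (1 + w) * d i), with x pivot killed by a unit d pivot.
    record Normal {k} (z : Fin (suc k) → R²) : Set where
      field
        w     : Fin (suc l)
        pivot : Fin k
        x d   : Fin (suc k) → A
      P : A
      P = π ^ suc (toℕ w)
      field
        x-zero  : x zero ≈ 1#
        d-zero  : d zero ≈ 0#
        x-pivot : P * x (suc pivot) ≈ 0#
        det     : ∀ i j → z i ∙ z j ⊥ ≈ (x i , P * d i) ∙ (x j , P * d j) ⊥

    module _ {k} {z : Fin (2 ℕ.+ k) → R²} (n : Normal z) where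
      open Normal n

      d-residue : Fin (suc k) → Fin Q
      d-residue i = residue (d (suc i))

      x-residue : Fin k → Fin Q
      x-residue i = residue (x (suc (punchIn pivot i)))

      -- The zeroth entries of `d` and `x` are 0 and 1 and need no record, which leaves k + 1
      -- residues for `d`. The pivot entry of `x` is harmless too, which leaves k residues for `x`.
      code : Fin (suc l ℕ.* (suc k ℕ.* (Q ℕ.^ suc k ℕ.* Q ℕ.^ k)))
      code = combine w (combine pivot (combine (funToFin d-residue) (funToFin x-residue)))

    -- A determinant of normalised points is built from products P (x i) (d j), and P contains a
    -- factor π. So residues determine it, except for the pivot entry of `x`, where P x vanishes for
    -- both configurations.
    code-∼ : ∀ {k} {z z′ : Fin (2 ℕ.+ k) → R²} (n : Normal z) (n′ : Normal z′) →
             code n ≡ code n′ → ∀ i j → z i ∙ z j ⊥ ≈ z′ i ∙ z′ j ⊥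
    code-∼ {k} n n′ code≡ with Fin.combine-injective (w n) _ (w n′) _ code≡
      where open Normal
    ... | w≡ , rest≡ with Fin.combine-injective (Normal.pivot n) _ (Normal.pivot n′) _ rest≡
    ...   | pivot≡ , rest≡′ = λ i j →
      trans (N.det i j) (trans (det-≈ _ _ _ _ _ _ _ _ (+-cong (xPd i j) (sym (Pdx i j)))) (sym (N′.det i j)))
      where
      module N = Normal n
      module N′ = Normal n′

      P≈ : N.P ≈ N′.P
      P≈ = reflexive (cong (λ w → π ^ suc (toℕ w)) w≡)

      scale : ∀ {a b} → π * a ≈ π * b → N.P * a ≈ N′.P * b
      scale {a} {b} eq = begin
        π * π ^ toℕ N.w * a    ≈⟨ *-congʳ (*-comm π _) ⟩
        π ^ toℕ N.w * π * a    ≈⟨ *-assoc _ π a ⟩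
        π ^ toℕ N.w * (π * a)  ≈⟨ *-congˡ eq ⟩
        π ^ toℕ N.w * (π * b)  ≈⟨ *-assoc _ π b ⟨
        π ^ toℕ N.w * π * b    ≈⟨ *-congʳ (*-comm _ π) ⟩
        N.P * b                ≈⟨ *-congʳ P≈ ⟩
        N′.P * b               ∎

      πd≈ : ∀ i → π * N.d i ≈ π * N′.d i
      πd≈ zero    = *-congˡ (trans N.d-zero (sym N′.d-zero))
      πd≈ (suc i) = residue-≈ (funToFin-injective (d-residue n) (d-residue n′)
        (Fin.combine-injectiveˡ _ _ _ (funToFin (x-residue n′)) rest≡′) i)

      Px≈ : ∀ i → N.P * N.x i ≈ N′.P * N′.x i
      Px≈ zero    = *-cong P≈ (trans N.x-zero (sym N′.x-zero))
      Px≈ (suc i) with N.pivot Fin.≟ i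
      ... | yes ≡.refl = trans N.x-pivot
              (≡.subst (λ p → 0# ≈ N′.P * N′.x (suc p)) (≡.sym pivot≡) (sym N′.x-pivot))
      ... | no pivot≢i = ≡.subst (λ i → N.P * N.x (suc i) ≈ N′.P * N′.x (suc i))
              (Fin.punchIn-punchOut pivot≢i) (scale (residue-≈ residue≡))
        where
        j = punchOut pivot≢i
        residue≡ : residue (N.x (suc (punchIn N.pivot j))) ≡ residue (N′.x (suc (punchIn N.pivot j)))
        residue≡ = ≡.trans
          (funToFin-injective (x-residue n) (x-residue n′)
            (Fin.combine-injectiveʳ (funToFin (d-residue n)) _ (funToFin (d-residue n′)) _ rest≡′) j)
          (cong (λ p → residue (N′.x (suc (punchIn p j)))) (≡.sym pivot≡))

      xPd : ∀ i j → N.x i * (N.P * N.d j) ≈ N′.x i * (N′.P * N′.d j)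
      xPd i j = begin
        -- The single factor P is lent first to `x` and then to `d`, because the two configurations
        -- agree in these entries only after multiplication by it.
        N.x i * (N.P * N.d j)     ≈⟨ swap (N.x i) N.P (N.d j) ⟩
        N.P * N.x i * N.d j       ≈⟨ *-congʳ (Px≈ i) ⟩
        N′.P * N′.x i * N.d j     ≈⟨ swap (N′.x i) N′.P (N.d j) ⟨
        N′.x i * (N′.P * N.d j)   ≈⟨ *-congˡ (*-congʳ P≈) ⟨
        N′.x i * (N.P * N.d j)    ≈⟨ *-congˡ (scale (πd≈ j)) ⟩
        N′.x i * (N′.P * N′.d j)  ∎
        where
        swap : ∀ a p b → a * (p * b) ≈ p * a * b
        swap = solve 3 (λ a p b → a :* (p :* b) := p :* a :* b) refl

      Pdx : ∀ i j → N.P * N.d i * N.x j ≈ N′.P * N′.d i * N′.x j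
      Pdx i j = trans (*-comm _ (N.x j)) (trans (xPd j i) (*-comm (N′.x j) _))

    module _ {m} (m≤φQ : m ≤ φ ℕ.* Q) where

      strip : Fin m → R²
      strip i = unit (quotient {φ} Q (inject≤ i m≤φQ))
              , π * representative (remainder {φ} Q (inject≤ i m≤φQ))

      strip-injective : ∀ {i j} → strip i ≋ strip j → i ≡ j
      strip-injective (eq₁ , eq₂) = Fin.inject≤-injective m≤φQ m≤φQ _ _
        (remQuot-injective {φ} Q (unit-injective eq₁) (representative-injective eq₂))

      normalise : ∀ {k} (z : Configuration (2 ℕ.+ k) (image strip)) → Normal (λ i → proj₁ (z i))
      normalise {k} z = record
        -- Adding t d to `x` is in general not a linear map of the points (x , P d), since t d need
        -- not be a multiple of P d. It still preserves determinants, because the new terms t (d i)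
        -- P (d j) and t (d j) P (d i) cancel.
        { w = w ; pivot = pivot ; x = λ i → x i + t * d i ; d = d
        ; x-zero = begin
            x zero + t * 0#              ≈⟨ solve 2 (λ x t → x :+ t :* con 0 := x) refl (x zero) t ⟩
            v * z₁ zero + 0# * z₂ zero   ≈⟨ solve 3 (λ v a b → v :* a :+ con 0 :* b := v :* a) refl v (z₁ zero) (z₂ zero) ⟩
            v * z₁ zero                  ≈⟨ vz≈1 ⟩
            1#                           ∎
        ; d-zero = refl
        ; x-pivot = P*x-pivot
        ; det = λ i j → begin
            proj₁ (z i) ∙ proj₁ (z j) ⊥             ≈⟨ det-linear v 0# (- z₂ zero) (z₁ zero) vz≈1+0 _ _ ⟨
            (x i , y i) ∙ (x j , y j) ⊥             ≈⟨ ∼-resp (λ i → x i , y i) (λ i → x i , P * d i) (λ i → refl , y≈Pd i) i j ⟩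
            (x i , P * d i) ∙ (x j , P * d j) ⊥     ≈⟨ det-≈ _ _ _ _ _ _ _ _
              (solve 6 (λ x₁ x₂ d₁ d₂ p t →
                 x₁ :* (p :* d₂) :+ (p :* d₁) :* (x₂ :+ t :* d₂) :=
                 (x₁ :+ t :* d₁) :* (p :* d₂) :+ (p :* d₁) :* x₂)
                 refl (x i) (x j) (d i) (d j) P t) ⟩
            (x i + t * d i , P * d i) ∙ (x j + t * d j , P * d j) ⊥ ∎
        }
        where
        z₁ z₂ c : Fin (2 ℕ.+ k) → A
        z₁ i = proj₁ (proj₁ (z i))
        z₂ i = proj₂ (proj₁ (z i))
        c i = representative (remainder {φ} Q (inject≤ (proj₁ (proj₂ (z i))) m≤φQ))

        u₀ = quotient {φ} Q (inject≤ (proj₁ (proj₂ (z zero))) m≤φQ)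
        v = inv u₀

        vz≈1 : v * z₁ zero ≈ 1#
        vz≈1 = trans (*-comm v (z₁ zero)) (trans (*-congʳ (proj₁ (proj₂ (proj₂ (z zero))))) (unit-inv u₀))

        vz≈1+0 : v * z₁ zero ≈ 1# + 0# * - z₂ zero
        vz≈1+0 = trans vz≈1 (solve 1 (λ m → con 1 := con 1 :+ con 0 :* m) refl (- z₂ zero))

        x y : Fin (2 ℕ.+ k) → A
        x i = proj₁ (linear v 0# (- z₂ zero) (z₁ zero) (proj₁ (z i)))
        y i = proj₂ (linear v 0# (- z₂ zero) (z₁ zero) (proj₁ (z i)))

        d₀ : Fin (suc k) → A
        d₀ i = - c zero * z₁ (suc i) + z₁ zero * c (suc i)

        y≈πd₀ : ∀ i → y (suc i) ≈ π * d₀ i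
        y≈πd₀ i = begin
          - z₂ zero * z₁ (suc i) + z₁ zero * z₂ (suc i)
            ≈⟨ +-cong (*-congʳ (-‿cong (proj₂ (proj₂ (proj₂ (z zero))))))
                      (*-congˡ (proj₂ (proj₂ (proj₂ (z (suc i)))))) ⟩
          - (π * c zero) * z₁ (suc i) + z₁ zero * (π * c (suc i))
            ≈⟨ +-congʳ (*-congʳ (-‿distribʳ-* π (c zero))) ⟩
          π * - c zero * z₁ (suc i) + z₁ zero * (π * c (suc i))
            ≈⟨ solve 5 (λ p m a b e → p :* m :* a :+ b :* (p :* e) := p :* (m :* a :+ b :* e))
                 refl π (- c zero) (z₁ (suc i)) (z₁ zero) (c (suc i)) ⟩
          π * d₀ i ∎

        y-zero : y zero ≈ 0#
        y-zero = begin
          - z₂ zero * z₁ zero + z₁ zero * z₂ zero   ≈⟨ +-cong (sym (-‿distribˡ-* (z₂ zero) (z₁ zero))) (*-comm (z₁ zero) (z₂ zero)) ⟩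
          - (z₂ zero * z₁ zero) + z₂ zero * z₁ zero ≈⟨ -‿inverseˡ _ ⟩
          0#                                        ∎

        factored = factor l d₀
        w = proj₁ factored
        d′ = proj₁ (proj₂ factored)

        P : A
        P = π ^ suc (toℕ w)

        d : Fin (2 ℕ.+ k) → A
        d zero    = 0#
        d (suc i) = d′ i

        y≈Pd : ∀ i → y i ≈ P * d i
        y≈Pd zero    = trans y-zero (sym (zeroʳ P))
        y≈Pd (suc i) = begin
          y (suc i)                ≈⟨ y≈πd₀ i ⟩
          π * d₀ i                 ≈⟨ *-congˡ (proj₁ (proj₂ (proj₂ factored)) i) ⟩
          π * (π ^ toℕ w * d′ i)   ≈⟨ *-assoc π _ (d′ i) ⟨
          P * d′ i                 ∎

        choice : ∃₂ λ pivot t → P * (x (suc pivot) + t * d (suc pivot)) ≈ 0#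
        choice with proj₂ (proj₂ (proj₂ factored))
        ... | inj₁ (i , s , ds≈1) = i , - (x (suc i) * s) , (begin
          P * (x (suc i) + - (x (suc i) * s) * d′ i) ≈⟨ *-congˡ (+-congˡ (-‿distribˡ-* _ (d′ i))) ⟨
          P * (x (suc i) - x (suc i) * s * d′ i)     ≈⟨ *-congˡ (+-congˡ (-‿cong (trans (*-assoc _ s (d′ i))
                                                         (trans (*-congˡ (trans (*-comm s (d′ i)) ds≈1)) (*-identityʳ _))))) ⟩
          P * (x (suc i) - x (suc i))                ≈⟨ *-congˡ (-‿inverseʳ _) ⟩
          P * 0#                                     ≈⟨ zeroʳ P ⟩
          0#                                         ∎)
        -- Here P = π ^ (l + 1) = 0 and every determinant vanishes, so the pivot and t are default
        -- values.
        ... | inj₂ w≡l = zero , 0# , trans (*-congʳ (trans (reflexive (cong (λ n → π ^ suc n) w≡l)) nilpotent)) (zeroˡ _)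

        pivot = proj₁ choice
        t = proj₁ (proj₂ choice)
        P*x-pivot = proj₂ (proj₂ choice)

      strip-classes : ∀ k {c} → 𝒞 R (2 ℕ.+ k) (image strip) HasSize c →
                      c ≤ suc l ℕ.* (suc k ℕ.* (Q ℕ.^ suc k ℕ.* Q ℕ.^ k))
      strip-classes k sizeC = Size.size-≤ (𝒞 R (2 ℕ.+ k) (image strip)) sizeC
        (λ z → code (normalise z)) λ {z} {z′} → code-∼ (normalise z) (normalise z′)

-- Units and residues in finite fields and in ℤ/p^ℓ

module Rings where
  open Counting
  open Classes
  open import Algebra.Bundles using (CommutativeRing; module Semiring)
  import Algebra.Definitions.RawSemiring as RawSemiring
  open import Data.Fin.Base using (Fin; zero; suc; toℕ; combine; quotient; remainder; punchIn; fromℕ<)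
  import Data.Fin.Properties as Fin
  open import Data.Integer.Base as ℤ using (ℤ; +_)
  open import Data.Integer.DivMod using (_%ℕ_; _/ℕ_; a≡a%ℕn+[a/ℕn]*n; n%ℕd<d)
  import Data.Integer.Divisibility.Signed as ℤ∣
  import Data.Integer.Properties as ℤ
  import Data.Integer.Tactic.RingSolver as ℤ
  open import Data.Nat.Base
  open import Data.Nat.Coprimality using (Coprime; coprime-factors; coprime-Bézout)
  open import Data.Nat.Divisibility using (_∣_; _∤_; divides; _∣?_; ∣m⇒∣m*n; ∣1⇒≡1; >⇒∤; ∣m+n∣m⇒∣n; m∣m*n)
  open import Data.Nat.GCD using (module Bézout)
  open import Data.Nat.Primality using (Prime; prime⇒irreducible; prime⇒nonZero; ¬prime[0]; ¬prime[1])
  open import Data.Nat.Properties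
  import Data.Nat.Tactic.RingSolver as ℕ
  open import Data.Product.Base using (∃-syntax; _,_; proj₁; proj₂)
  open import Data.Sum.Base using (_⊎_; inj₁; inj₂)
  open import Function.Bundles using (module Inverse)
  open import Relation.Binary.PropositionalEquality as ≡ using (_≡_; refl; cong; cong₂; subst; sym; trans)
  open import Relation.Nullary using (¬_; yes; no; contradiction)

  fieldUnits : ∀ {R q} → IsField R → CommutativeRing.setoid R HasSize q → 2 ≤ q → Units R q
  fieldUnits {R} {suc φ} isField size (s≤s 1≤φ) = record
    { size           = size
    ; φ              = φ
    ; unit           = unit
    ; inv            = λ i → proj₁ (inverse (unit i) (unit≉0 i))
    ; unit-injective = λ eq → Fin.punchIn-injective (from 0#) _ _ (to-injective size eq)
    ; unit-inv       = λ i → proj₂ (inverse (unit i) (unit≉0 i))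
    ; q≤2φ           = +-mono-≤ 1≤φ (m≤m+n φ 0)
    }
    where
    open CommutativeRing R using (setoid; Carrier; _≈_; 0#)
    open IsField isField
    open Size setoid
    open Inverse size using (to; from; from-cong)

    unit : Fin φ → Carrier
    unit i = to (punchIn (from 0#) i)

    unit≉0 : ∀ i → ¬ (unit i ≈ 0#)
    unit≉0 i eq = Fin.punchInᵢ≢i (from 0#) i
      (to-injective size (CommutativeRing.trans R eq (proj₂ (to-surjective size 0#))))

  module ℤ/-Properties (n : ℕ) where
    open CommutativeRing (ℤ/ n) using (_≈_; setoid)

    ≡⇒≈ : ∀ {x y : ℤ} → x ≡ y → x ≈ y
    ≡⇒≈ {x} {y} = CommutativeRing.reflexive (ℤ/ n) {x} {y}

    private
      ordered : ∀ {i j} → i < n → j ≤ i → + i ≈ + j → i ≡ j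
      ordered {i} {j} i<n j≤i eq with i ∸ j in i∸j≡
      ... | zero  = ≤-antisym (m∸n≡0⇒m≤n i∸j≡) j≤i
      ... | suc d = contradiction
        (subst (n ∣_) (trans (cong ℤ.∣_∣ (trans (ℤ.m-n≡m⊖n i j) (ℤ.⊖-≥ j≤i))) i∸j≡) (ℤ∣.∣⇒∣ᵤ eq))
        (>⇒∤ (subst (_< n) i∸j≡ (≤-<-trans (m∸n≤m i j) i<n)))

    +-injective-< : ∀ {i j} → i < n → j < n → + i ≈ + j → i ≡ j
    +-injective-< {i} {j} i<n j<n eq with ≤-total j i
    ... | inj₁ j≤i = ordered i<n j≤i eq
    ... | inj₂ i≤j = sym (ordered j<n i≤j (CommutativeRing.sym (ℤ/ n) {+ i} {+ j} eq))

    module _ .{{_ : NonZero n}} where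

      ≈-remainder : ∀ x → x ≈ + (x %ℕ n)
      ≈-remainder x = ℤ∣.divides (x /ℕ n)
        (trans (cong (ℤ._- + (x %ℕ n)) (a≡a%ℕn+[a/ℕn]*n x n)) (lemma (+ (x %ℕ n)) (x /ℕ n ℤ.* + n)))
        where
        lemma : ∀ a b → (a ℤ.+ b) ℤ.- a ≡ b
        lemma = ℤ.solve-∀

      ℤ/-size : setoid HasSize n
      ℤ/-size = Size.hasSize setoid (λ i → + toℕ i)
        (λ {i} {j} eq → Fin.toℕ-injective (+-injective-< (Fin.toℕ<n i) (Fin.toℕ<n j) eq))
        (λ x → fromℕ< (n%ℕd<d x n) , subst (λ r → x ≈ + r) (sym (Fin.toℕ-fromℕ< (n%ℕd<d x n))) (≈-remainder x))

    private
      absolute : ∀ x → ∃[ σ ] x ℤ.* σ ≡ + ℤ.∣ x ∣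
      absolute x with ℤ.+∣i∣≡i⊎+∣i∣≡-i x
      ... | inj₁ eq = + 1 , trans (ℤ.*-identityʳ x) (sym eq)
      ... | inj₂ eq = ℤ.- + 1 , trans (lemma x) (sym eq)
        where
        lemma : ∀ x → x ℤ.* ℤ.- + 1 ≡ ℤ.- x
        lemma = ℤ.solve-∀

      bézout : ∀ u m v → 1 + v * n ≡ u * m → + u ℤ.* + m ≡ + 1 ℤ.+ + v ℤ.* + n
      bézout u m v eq = trans (sym (ℤ.pos-* u m)) (trans (cong +_ (sym eq)) (cong (λ m → + 1 ℤ.+ m) (ℤ.pos-* v n)))

    -- Bézout's identity over the naturals concerns the absolute value and comes with either sign.
    -- The factor σ restores the sign of `x`, and the second case takes - u in place of u.
    coprime⇒invertible : ∀ x → Coprime ℤ.∣ x ∣ n → ∃[ y ] x ℤ.* y ≈ + 1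
    coprime⇒invertible x coprime with absolute x | coprime-Bézout coprime
    ... | σ , xσ≡∣x∣ | Bézout.+- u v eq = σ ℤ.* + u , ℤ∣.divides (+ v) (begin
      x ℤ.* (σ ℤ.* + u) ℤ.- + 1         ≡⟨ rearrange x σ (+ u) ⟩
      + u ℤ.* (x ℤ.* σ) ℤ.- + 1         ≡⟨ cong (λ m → + u ℤ.* m ℤ.- + 1) xσ≡∣x∣ ⟩
      + u ℤ.* + ℤ.∣ x ∣ ℤ.- + 1         ≡⟨ cong (ℤ._- + 1) (bézout u ℤ.∣ x ∣ v eq) ⟩
      + 1 ℤ.+ + v ℤ.* + n ℤ.- + 1       ≡⟨ cancel (+ v ℤ.* + n) ⟩
      + v ℤ.* + n                       ∎)
      where
      open ≡.≡-Reasoning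
      rearrange : ∀ x σ u → x ℤ.* (σ ℤ.* u) ℤ.- + 1 ≡ u ℤ.* (x ℤ.* σ) ℤ.- + 1
      rearrange = ℤ.solve-∀
      cancel : ∀ a → + 1 ℤ.+ a ℤ.- + 1 ≡ a
      cancel = ℤ.solve-∀
    ... | σ , xσ≡∣x∣ | Bézout.-+ u v eq = σ ℤ.* ℤ.- + u , ℤ∣.divides (ℤ.- + v) (begin
      x ℤ.* (σ ℤ.* ℤ.- + u) ℤ.- + 1     ≡⟨ rearrange x σ (+ u) ⟩
      ℤ.- (+ 1 ℤ.+ + u ℤ.* (x ℤ.* σ))   ≡⟨ cong (λ m → ℤ.- (+ 1 ℤ.+ + u ℤ.* m)) xσ≡∣x∣ ⟩
      ℤ.- (+ 1 ℤ.+ + u ℤ.* + ℤ.∣ x ∣)   ≡⟨ cong (λ m → ℤ.- (+ 1 ℤ.+ m)) (ℤ.pos-* u ℤ.∣ x ∣) ⟨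
      ℤ.- + (1 + u * ℤ.∣ x ∣)           ≡⟨ cong (λ m → ℤ.- + m) eq ⟩
      ℤ.- + (v * n)                     ≡⟨ cong ℤ.-_ (ℤ.pos-* v n) ⟩
      ℤ.- (+ v ℤ.* + n)                 ≡⟨ ℤ.neg-distribˡ-* (+ v) (+ n) ⟩
      ℤ.- + v ℤ.* + n                   ∎)
      where
      open ≡.≡-Reasoning
      rearrange : ∀ x σ u → x ℤ.* (σ ℤ.* ℤ.- u) ℤ.- + 1 ≡ ℤ.- (+ 1 ℤ.+ u ℤ.* (x ℤ.* σ))
      rearrange = ℤ.solve-∀

  coprime-^ : ∀ {m p} → Coprime m p → ∀ l → Coprime m (p ^ l)
  coprime-^ _ zero (_ , d∣1) = ∣1⇒≡1 d∣1
  coprime-^ {p = p} c (suc l) (d∣m , d∣ppˡ) =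
    coprime-^ c l (d∣m , coprime-factors c (∣m⇒∣m*n (p ^ l) d∣m , d∣ppˡ))

  prime-∤⇒coprime : ∀ {p m} → Prime p → p ∤ m → Coprime m p
  prime-∤⇒coprime isPrime p∤m (d∣m , d∣p) with prime⇒irreducible isPrime d∣p
  ... | inj₁ d≡1 = d≡1
  ... | inj₂ d≡p = contradiction (subst (_∣ _) d≡p d∣m) p∤m

  module PrimePower {p : ℕ} (isPrime : Prime p) (l : ℕ) where
    private
      instance
        p≢0 : NonZero p
        p≢0 = prime⇒nonZero isPrime

      Q n : ℕ
      Q = p ^ l
      n = p ^ suc l

      instance
        Q≢0 : NonZero Q
        Q≢0 = m^n≢0 p l

    open ℤ/-Properties n
    open CommutativeRing (ℤ/ n) using (_≈_; semiring)
    open RawSemiring (Semiring.rawSemiring semiring) using () renaming (_^_ to _^ᴿ_)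

    ∤⇒invertible : ∀ x → p ∤ ℤ.∣ x ∣ → ∃[ y ] x ℤ.* y ≈ + 1
    ∤⇒invertible x p∤x = coprime⇒invertible x (coprime-^ (prime-∤⇒coprime isPrime p∤x) (suc l))

    invertible-or-multiple : ∀ x → (∃[ y ] x ℤ.* y ≈ + 1) ⊎ (∃[ y ] x ≈ + p ℤ.* y)
    invertible-or-multiple x with p ∣? ℤ.∣ x ∣
    ... | no  p∤x = inj₁ (∤⇒invertible x p∤x)
    ... | yes p∣x with ℤ∣.∣ᵤ⇒∣ {+ p} {x} p∣x
    ...   | ℤ∣.divides y x≡yp = inj₂ (y , ≡⇒≈ (trans x≡yp (ℤ.*-comm y (+ p))))

    nilpotent : (+ p) ^ᴿ suc l ≈ + 0
    nilpotent = ℤ∣.divides (+ 1) (trans (ℤ.+-identityʳ _) (trans (^ᴿ≡^ (suc l)) (sym (ℤ.*-identityˡ (+ n)))))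
      where
      ^ᴿ≡^ : ∀ k → (+ p) ^ᴿ k ≡ + (p ^ k)
      ^ᴿ≡^ zero    = refl
      ^ᴿ≡^ (suc k) = trans (cong (λ m → + p ℤ.* m) (^ᴿ≡^ k)) (sym (ℤ.pos-* p (p ^ k)))

    residue : ℤ → Fin Q
    residue x = fromℕ< (n%ℕd<d x Q)

    -- With a common remainder modulo Q, the difference p x - p y is p Q = n times the difference of
    -- the quotients.
    residue-≈ : ∀ {x y} → residue x ≡ residue y → + p ℤ.* x ≈ + p ℤ.* y
    residue-≈ {x} {y} eq = ℤ∣.divides (x /ℕ Q ℤ.- y /ℕ Q) (begin
      + p ℤ.* x ℤ.- + p ℤ.* y
        ≡⟨ cong₂ (λ x y → + p ℤ.* x ℤ.- + p ℤ.* y) (a≡a%ℕn+[a/ℕn]*n x Q) (a≡a%ℕn+[a/ℕn]*n y Q) ⟩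
      + p ℤ.* (+ (x %ℕ Q) ℤ.+ x /ℕ Q ℤ.* + Q) ℤ.- + p ℤ.* (+ (y %ℕ Q) ℤ.+ y /ℕ Q ℤ.* + Q)
        ≡⟨ cong (λ r → + p ℤ.* (+ r ℤ.+ x /ℕ Q ℤ.* + Q) ℤ.- + p ℤ.* (+ (y %ℕ Q) ℤ.+ y /ℕ Q ℤ.* + Q)) remainders≡ ⟩
      + p ℤ.* (+ (y %ℕ Q) ℤ.+ x /ℕ Q ℤ.* + Q) ℤ.- + p ℤ.* (+ (y %ℕ Q) ℤ.+ y /ℕ Q ℤ.* + Q)
        ≡⟨ lemma (+ p) (+ Q) (+ (y %ℕ Q)) (x /ℕ Q) (y /ℕ Q) ⟩
      (x /ℕ Q ℤ.- y /ℕ Q) ℤ.* (+ p ℤ.* + Q)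
        ≡⟨ cong ((x /ℕ Q ℤ.- y /ℕ Q) ℤ.*_) (ℤ.pos-* p Q) ⟨
      (x /ℕ Q ℤ.- y /ℕ Q) ℤ.* + n ∎)
      where
      open ≡.≡-Reasoning
      remainders≡ : x %ℕ Q ≡ y %ℕ Q
      remainders≡ = Fin.fromℕ<-injective _ _ (n%ℕd<d x Q) (n%ℕd<d y Q) eq
      lemma : ∀ p q r a b → p ℤ.* (r ℤ.+ a ℤ.* q) ℤ.- p ℤ.* (r ℤ.+ b ℤ.* q) ≡ (a ℤ.- b) ℤ.* (p ℤ.* q)
      lemma = ℤ.solve-∀

    representative-injective : ∀ {i j : Fin Q} → + p ℤ.* + toℕ i ≈ + p ℤ.* + toℕ j → i ≡ j
    representative-injective {i} {j} eq = Fin.toℕ-injective (*-cancelˡ-≡ _ _ p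
      (+-injective-< (*-monoʳ-< p (Fin.toℕ<n i)) (*-monoʳ-< p (Fin.toℕ<n j))
        (≡.subst₂ _≈_ (sym (ℤ.pos-* p (toℕ i))) (sym (ℤ.pos-* p (toℕ j))) eq)))

  primePowerUnits : ∀ {p} → Prime p → ∀ l → Units (ℤ/ (p ^ suc l)) (p ^ suc l)
  primePowerUnits {0} isPrime _ = contradiction isPrime ¬prime[0]
  primePowerUnits {1} isPrime _ = contradiction isPrime ¬prime[1]
  primePowerUnits {p@(suc p′@(suc p″))} isPrime l = record
    { size           = ℤ/-size {{m^n≢0 p (suc l)}}
    ; φ              = p′ * Q
    ; unit           = λ i → + toℕ (digits i)
    ; inv            = λ i → proj₁ (invertible i)
    ; unit-injective = λ {i} {j} eq → digits-injective (Fin.toℕ-injective (+-injective-< (digits<n i) (digits<n j) eq))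
    ; unit-inv       = λ i → proj₂ (invertible i)
    ; q≤2φ           = ≤-trans (*-monoˡ-≤ Q (+-monoʳ-≤ 1 (m≤n+m p′ p″))) (≤-reflexive (lemma p″ Q))
    }
    where
    open PrimePower isPrime l
    open CommutativeRing (ℤ/ (p ^ suc l)) using (_≈_)
    open ℤ/-Properties (p ^ suc l)

    Q : ℕ
    Q = p ^ l

    lemma : ∀ a b → (1 + (a + suc a)) * b ≡ 2 * (suc a * b)
    lemma = ℕ.solve-∀

    -- b * p + (1 + a), whose last digit 1 + a in base p is nonzero
    digits : Fin (p′ * Q) → Fin (Q * p)
    digits i = combine (remainder {p′} Q i) (suc (quotient {p′} Q i))

    digits-injective : ∀ {i j} → digits i ≡ digits j → i ≡ j
    digits-injective {i} {j} eq = remQuot-injective {p′} Q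
      (Fin.suc-injective (Fin.combine-injectiveʳ (remainder {p′} Q i) _ (remainder {p′} Q j) _ eq))
      (Fin.combine-injectiveˡ (remainder {p′} Q i) _ (remainder {p′} Q j) _ eq)

    digits<n : ∀ i → toℕ (digits i) < p * Q
    digits<n i = subst (toℕ (digits i) <_) (*-comm Q p) (Fin.toℕ<n (digits i))

    p∤digits : ∀ i → p ∤ toℕ (digits i)
    p∤digits i p∣ = >⇒∤ (s≤s (Fin.toℕ<n (quotient {p′} Q i)))
      (∣m+n∣m⇒∣n (subst (p ∣_) (Fin.toℕ-combine (remainder {p′} Q i) _) p∣) (m∣m*n (toℕ (remainder {p′} Q i))))

    invertible : ∀ i → ∃[ y ] + toℕ (digits i) ℤ.* y ≈ + 1
    invertible i = ∤⇒invertible (+ toℕ (digits i)) (p∤digits i)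

  primePowerLocal : ∀ {p} → Prime p → ∀ l → Local (ℤ/ (p ^ suc l)) (p ^ suc l) l (p ^ l)
  primePowerLocal {p} isPrime l = record
    { units                    = primePowerUnits isPrime l
    ; π                        = + p
    ; nilpotent                = nilpotent
    ; unit-or-π                = invertible-or-multiple
    ; residue                  = residue
    ; residue-≈                = λ {x} {y} → residue-≈ {x} {y}
    ; representative           = λ i → + toℕ i
    ; representative-injective = representative-injective
    }
    where open PrimePower isPrime l

-- Choice of the sets and comparison of growth

module Asymptotics where
  open Powers
  open Counting
  open Classes
  open Rings
  open import Algebra.Bundles using (CommutativeRing)
  import Data.Fin.Properties as Fin
  open import Data.Integer.Base as ℤ using (+_; -[1+_])
  import Data.Integer.Properties as ℤ
  import Data.Integer.Tactic.RingSolver as ℤ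
  open import Data.Nat.Base
  open import Data.Nat.DivMod using (_/_; _%_; m/n*n≤m; m≡m%n+[m/n]*n; m%n<n; m≥n⇒m/n>0)
  open import Data.Nat.Properties
  import Data.Nat.Tactic.RingSolver as ℕ
  open import Data.Product.Base using (Σ-syntax; ∃-syntax; _×_; _,_; proj₁; proj₂)
  open import Data.Rational.Base as ℚ using (ℚ; mkℚ; 0ℚ; toℚᵘ)
  import Data.Rational.Properties as ℚ
  open import Data.Rational.Unnormalised.Base as ℚᵘ using (mkℚᵘ)
  import Data.Rational.Unnormalised.Properties as ℚᵘ
  open import Data.Sum.Base using (_⊎_; inj₁; inj₂)
  open import Function.Bundles using (module Inverse)
  open import Level using (0ℓ)
  open import Relation.Binary.PropositionalEquality as ≡ using (_≡_; cong; cong₂; subst; sym; trans)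
  open import Relation.Nullary using (yes; no)

  square : ∀ x n → (x * x) ^ n ≡ x ^ (2 * n)
  square x n = trans (cong (λ y → (x * y) ^ n) (sym (*-identityʳ x))) (^-*-assoc x 2 n)

  two-minus : ∀ a c d → c + a ≡ 2 * suc d →
              toℚᵘ (+ 2 ℚ./ 1 ℚ.- + a ℚ./ suc d) ℚᵘ.≃ mkℚᵘ (+ c) d
  two-minus a c d c+a≡ = begin
    toℚᵘ (+ 2 ℚ./ 1 ℚ.- + a ℚ./ suc d)           ≈⟨ ℚ.toℚᵘ-homo-+ (+ 2 ℚ./ 1) (ℚ.- (+ a ℚ./ suc d)) ⟩
    toℚᵘ (+ 2 ℚ./ 1) ℚᵘ.+ toℚᵘ (ℚ.- (+ a ℚ./ suc d)) ≈⟨ ℚᵘ.+-congʳ (toℚᵘ (+ 2 ℚ./ 1)) (ℚ.toℚᵘ-homo‿- (+ a ℚ./ suc d)) ⟩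
    toℚᵘ (+ 2 ℚ./ 1) ℚᵘ.- toℚᵘ (+ a ℚ./ suc d)   ≈⟨ ℚᵘ.+-cong (/-≃ (+ 2) 0) (ℚᵘ.-‿cong (/-≃ (+ a) d)) ⟩
    mkℚᵘ (+ 2) 0 ℚᵘ.- mkℚᵘ (+ a) d               ≈⟨ ℚᵘ.*≡* cross ⟩
    mkℚᵘ (+ c) d                                 ∎
    where
    open ℚᵘ.≃-Reasoning
    lemma : ∀ a c D → (c ℤ.+ a ℤ.+ ℤ.- a ℤ.* + 1) ℤ.* D ≡ c ℤ.* (+ 1 ℤ.* D)
    lemma = ℤ.solve-∀
    cross : (+ 2 ℤ.* + suc d ℤ.+ ℤ.- + a ℤ.* + 1) ℤ.* + suc d ≡ + c ℤ.* + (1 * suc d)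
    cross = trans (cong (λ e → (e ℤ.+ ℤ.- + a ℤ.* + 1) ℤ.* + suc d)
                     (trans (sym (ℤ.pos-* 2 (suc d))) (cong +_ (sym c+a≡))))
                  (trans (lemma (+ a) (+ c) (+ suc d)) (cong (+ c ℤ.*_) (sym (ℤ.pos-* 1 (suc d)))))

  module _ {a} {I : Set a} (R : I → CommutativeRing 0ℓ 0ℓ) (q b : I → ℕ)
           (U : ∀ i → Units (R i) (q i)) where

    -- A positive ε with denominator d + 1 is at least 1 / (d + 1), so it is enough to beat every
    -- natural factor D.
    ≪-intro : ∀ n (E : ∀ i → Subset (R i)) {m : I → ℕ} → (∀ i → ⟦ R i ∣ E i ⟧ HasSize m i) →
      (∀ D → ∃[ N ] ∀ i → N ≤ b i → ∀ {c n′} → 𝒞 (R i) n (E i) HasSize c →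
         𝒞 (R i) n (full (R i)) HasSize n′ → D * c ≤ n′) →
      Size (λ i → 𝒞 (R i) n (E i)) ≪ (λ i → 𝒞 (R i) n (full (R i))) as b →∞
    ≪-intro n E size bound (mkℚ -[1+ _ ] _ _) (ℚ.*<* ())
    ≪-intro n E size bound (mkℚ (+ 0) _ _) (ℚ.*<* (ℤ.+<+ ()))
    ≪-intro n E size bound ε@(mkℚ (+ suc u) d _) _ =
      proj₁ (bound (suc d)) , λ i N≤b →
        let c , sizeC = FinitePlane.𝒞-size (R i) (Units.size (U i)) n (E i) (size i)
            N , sizeN = FinitePlane.𝒞-size (R i) (Units.size (U i)) n (full (R i))
                          (FinitePlane.full-size (R i) (Units.size (U i)))
        in c , N , sizeC , sizeN , ratio c N (proj₂ (bound (suc d)) i N≤b sizeC sizeN)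
      where
      ratio : ∀ c n → suc d * c ≤ n → (+ c ℚ./ 1) ℚ.≤ ε ℚ.* (+ n ℚ./ 1)
      ratio c n Dc≤n = ℚ.toℚᵘ-cancel-≤ (begin
        toℚᵘ (+ c ℚ./ 1)                 ≃⟨ /-≃ (+ c) 0 ⟩
        mkℚᵘ (+ c) 0                     ≤⟨ ℚᵘ.*≤* (≡.subst₂ ℤ._≤_ (ℤ.pos-* c (suc d * 1)) eq (ℤ.+≤+ ineq)) ⟩
        mkℚᵘ (+ suc u) d ℚᵘ.* mkℚᵘ (+ n) 0 ≃⟨ ℚᵘ.*-congˡ {toℚᵘ ε} (/-≃ (+ n) 0) ⟨
        toℚᵘ ε ℚᵘ.* toℚᵘ (+ n ℚ./ 1)     ≃⟨ ℚ.toℚᵘ-homo-* ε (+ n ℚ./ 1) ⟨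
        toℚᵘ (ε ℚ.* (+ n ℚ./ 1))         ∎)
        where
        open ℚᵘ.≤-Reasoning
        ineq : c * (suc d * 1) ≤ suc u * n
        ineq = ≤-trans (≤-reflexive (trans (*-comm c (suc d * 1)) (cong (_* c) (*-identityʳ (suc d)))))
                       (≤-trans Dc≤n (m≤n*m n (suc u)))
        eq : + (suc u * n) ≡ + suc u ℤ.* + n ℤ.* + 1
        eq = trans (ℤ.pos-* (suc u) n) (sym (ℤ.*-identityʳ (+ suc u ℤ.* + n)))

  module _ {R : CommutativeRing 0ℓ 0ℓ} {q} (U : Units R q) where
    open Units U

    q≢0 : NonZero q
    q≢0 = Fin.nonZeroIndex (Inverse.from size (CommutativeRing.0# R))

    -- The plane has at least (q * q) ^ (1 + k) / 2 q classes.
    few-classes : ∀ k D {c n} → 𝒞 R (2 + k) (full R) HasSize n →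
                  2 * D * (c * q) ≤ (q * q) ^ suc k → D * c ≤ n
    few-classes k D {c} {n} sizeN few = *-cancelʳ-≤ (D * c) n (2 * q) {{m*n≢0 2 q {{_}} {{q≢0}}}} (begin
      D * c * (2 * q)           ≡⟨ lemma₁ D c q ⟩
      2 * D * (c * q)           ≤⟨ few ⟩
      q * q * (q * q) ^ k       ≤⟨ *-monoˡ-≤ ((q * q) ^ k) (*-monoˡ-≤ q q≤2φ) ⟩
      2 * φ * q * (q * q) ^ k   ≡⟨ lemma₂ φ q ((q * q) ^ k) ⟩
      φ * (q * q) ^ k * (2 * q) ≤⟨ *-monoˡ-≤ (2 * q) (Rows.full-classes U k sizeN) ⟩
      n * (2 * q)               ∎)
      where
      open ≤-Reasoning
      lemma₁ : ∀ D c q → D * c * (2 * q) ≡ 2 * D * (c * q)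
      lemma₁ = ℕ.solve-∀
      lemma₂ : ∀ φ q x → 2 * φ * q * x ≡ φ * x * (2 * q)
      lemma₂ = ℕ.solve-∀

  record Selection (R : CommutativeRing 0ℓ 0ℓ) (m₀ : ℕ) : Set₁ where
    field
      subset : Subset R
      {m}    : ℕ
      size   : ⟦ R ∣ subset ⟧ HasSize m
      m≤m₀   : m ≤ m₀
      m₀≤4m  : m₀ ≤ 4 * m

  selection-≈ : ∀ {a} {I : Set a} {R : I → CommutativeRing 0ℓ 0ℓ} (b : I → ℕ) s (m₀ : I → ℕ) →
    (∀ i → (m₀ i ≤ 2 · b i ^ℝ s) × (b i ^ℝ s ≤ 4 · m₀ i)) → (S : ∀ i → Selection (R i) (m₀ i)) →
    Size (λ i → ⟦ R i ∣ Selection.subset (S i) ⟧) ≈ b ^ s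
  -- From below, the 4 lost in approximating b ^ s multiplies the 4 lost in the selection; the upper
  -- constant 2 is enlarged to match.
  selection-≈ b s m₀ approx S = 16 , λ i → let open Selection (S i) in
    m , size , ≤^ℝ-mono s m≤m₀ (m≤m+n 2 14) (proj₁ (approx i)) , ^ℝ≤-mono {Y = m} s 4 4 m₀≤4m (proj₂ (approx i))

  module _ {R : CommutativeRing 0ℓ 0ℓ} {q} (U : Units R q) where
    open Units U
    open Rows U
    open FinitePlane R

    -- Multiplying the count by q completes a ^ (k + 1) q ^ k to the power (a q) ^ (k + 1), which is
    -- compared with m₀ directly.
    select-rows : ∀ m₀ → m₀ ≤ 2 * (q * q) →
      Σ[ S ∈ Selection R m₀ ] (∀ k {c} → 𝒞 R (suc k) (Selection.subset S) HasSize c →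
                                    c * q ≤ q ⊎ c * q ≤ m₀ ^ suc k)
    select-rows m₀ m₀≤2q² with m₀ ≤? q
    ... | yes m₀≤q = record
      { subset = image (axis m₀≤q)
      ; size   = image-size (axis m₀≤q) (axis-injective m₀≤q)
      ; m≤m₀   = ≤-refl
      ; m₀≤4m  = m≤n*m m₀ 4
      } , λ k sizeC → inj₁ (≤-trans (*-monoˡ-≤ q (axis-classes m₀≤q (suc k) sizeC)) (≤-reflexive (*-identityˡ q)))
    ... | no m₀≰q = record
      { subset = image (rows a≤φ)
      ; size   = image-size (rows a≤φ) (rows-injective a≤φ)
      ; m≤m₀   = aq≤m₀
      ; m₀≤4m  = m₀≤4aq
      } , λ k {c} sizeC → inj₂ (begin
        c * q                       ≤⟨ *-monoˡ-≤ q (rows-classes a≤φ k sizeC) ⟩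
        a ^ suc k * q ^ k * q       ≡⟨ trans (*-assoc (a ^ suc k) (q ^ k) q) (cong (a ^ suc k *_) (*-comm (q ^ k) q)) ⟩
        a ^ suc k * q ^ suc k       ≡⟨ *-^-distrib a q (suc k) ⟨
        (a * q) ^ suc k             ≤⟨ ^-monoˡ-≤ (suc k) aq≤m₀ ⟩
        m₀ ^ suc k                  ∎)
      where
      open ≤-Reasoning
      instance _ = q≢0 U
      r a : ℕ
      r = m₀ / q
      -- The quotient m₀ / q may exceed the number of listed units. In that case all φ rows are
      -- taken, and m₀ ≤ 2 q ² ≤ 4 φ q limits the loss.
      a = r ⊓ φ

      a≤φ : a ≤ φ
      a≤φ = m⊓n≤n r φ

      aq≤m₀ : a * q ≤ m₀
      aq≤m₀ = ≤-trans (*-monoˡ-≤ q (m⊓n≤m r φ)) (m/n*n≤m m₀ q)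

      m₀≤4rq : m₀ ≤ 4 * (r * q)
      m₀≤4rq = begin
        m₀                      ≡⟨ m≡m%n+[m/n]*n m₀ q ⟩
        m₀ % q + r * q ≤⟨ +-monoˡ-≤ (r * q) (<⇒≤ (m%n<n m₀ q)) ⟩
        q + r * q               ≤⟨ +-monoˡ-≤ (r * q) (m≤n*m q r {{>-nonZero (m≥n⇒m/n>0 (<⇒≤ (≰⇒> m₀≰q)))}}) ⟩
        r * q + r * q           ≤⟨ +-monoʳ-≤ (r * q) (m≤m+n (r * q) (2 * (r * q))) ⟩
        4 * (r * q)             ∎

      m₀≤4φq : m₀ ≤ 4 * (φ * q)
      m₀≤4φq = begin
        m₀              ≤⟨ m₀≤2q² ⟩
        2 * (q * q)     ≤⟨ *-monoʳ-≤ 2 (*-monoˡ-≤ q q≤2φ) ⟩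
        2 * (2 * φ * q) ≡⟨ lemma φ q ⟩
        4 * (φ * q)     ∎
        where
        lemma : ∀ φ q → 2 * (2 * φ * q) ≡ 4 * (φ * q)
        lemma = ℕ.solve-∀

      m₀≤4aq : m₀ ≤ 4 * (a * q)
      m₀≤4aq with ⊓-sel r φ
      ... | inj₁ eq = subst (λ a → m₀ ≤ 4 * (a * q)) (sym eq) m₀≤4rq
      ... | inj₂ eq = subst (λ a → m₀ ≤ 4 * (a * q)) (sym eq) m₀≤4φq

  -- The ring size q, which governs |E|, is kept apart from the parameter b that tends to infinity:
  -- over ℤ/p^ℓ these are p ^ ℓ and p.
  rows-case : ∀ {i} {I : Set i} (R : I → CommutativeRing 0ℓ 0ℓ) (q b : I → ℕ) →
    (∀ i → Units (R i) (q i)) → (∀ i → b i ≤ q i) →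
    ∀ k s → 0ℚ ≤ᵣ s → s <ᵣ + 2 ℚ./ 1 ℚ.- + 2 ℚ./ (2 + k) →
    Σ[ E ∈ (∀ i → Subset (R i)) ]
        (Size (λ i → ⟦ R i ∣ E i ⟧) ≈ q ^ s)
      × (Size (λ i → 𝒞 (R i) (2 + k) (E i)) ≪ (λ i → 𝒞 (R i) (2 + k) (full (R i))) as b →∞)
  rows-case {I = I} R q b U b≤q k s 0≤s s<x =
    (λ i → Selection.subset (S i)) , selection-≈ q s m₀ approx S
    , ≪-intro R q b U (2 + k) (λ i → Selection.subset (S i)) (λ i → Selection.size (S i)) λ D → N D , λ i N≤b {c} sizeC sizeN →
        few-classes (U i) k D {c} sizeN (few D i c (≤-trans N≤b (b≤q i)) (proj₂ (selected i) (suc k) sizeC))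
    where
    open Cut s
    open ≤-Reasoning

    x≃ : toℚᵘ (+ 2 ℚ./ 1 ℚ.- + 2 ℚ./ (2 + k)) ℚᵘ.≃ mkℚᵘ (+ (2 * suc k)) (suc k)
    x≃ = two-minus 2 (2 * suc k) (suc k) (lemma k)
      where
      lemma : ∀ k → 2 * suc k + 2 ≡ 2 * suc (suc k)
      lemma = ℕ.solve-∀

    module _ (i : I) where
      approximated = approximation 0≤s (q i) {{q≢0 (U i)}}
      m₀ = proj₁ approximated
      approx = proj₂ (proj₂ approximated)

      m₀≤2q² : m₀ ≤ 2 * (q i * q i)
      m₀≤2q² = ^-cancelˡ-≤ (2 + k) m₀ (2 * (q i * q i)) (begin
        m₀ ^ (2 + k)                            ≤⟨ bounded-by 0≤s x≃ s<x m₀ 2 (q i) (proj₁ approx) ⟩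
        2 ^ (2 + k) * q i ^ (2 * suc k)         ≤⟨ *-monoʳ-≤ (2 ^ (2 + k)) (^-monoʳ-≤ (q i) {{q≢0 (U i)}} (*-monoʳ-≤ 2 (n≤1+n (suc k)))) ⟩
        2 ^ (2 + k) * q i ^ (2 * (2 + k))       ≡⟨ cong (2 ^ (2 + k) *_) (square (q i) (2 + k)) ⟨
        2 ^ (2 + k) * (q i * q i) ^ (2 + k)     ≡⟨ *-^-distrib 2 (q i * q i) (2 + k) ⟨
        (2 * (q i * q i)) ^ (2 + k)             ∎)

      selected = select-rows (U i) m₀ m₀≤2q²
      S = proj₁ selected

    gap = bounded-below 0≤s x≃ s<x
    u = proj₁ gap
    e = suc (proj₁ (proj₂ gap))

    -- With K = k + 2 the gap gives m₀ ^ e ≤ 2 ^ e q ^ u and u K + 1 ≤ 2 (k + 1) e. So (2 D m₀ ^ K)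
    -- ^ e is at most `N D` times q ^ (u K), and the spare factor q absorbs `N D`.
    N : ℕ → ℕ
    N D = (2 * D * 2 ^ (2 + k)) ^ e

    few : ∀ D i c → N D ≤ q i → c * q i ≤ q i ⊎ c * q i ≤ m₀ i ^ (2 + k) →
          2 * D * (c * q i) ≤ (q i * q i) ^ suc k
    few zero i _ _ _ = z≤n
    few D@(suc D′) i c N≤q (inj₁ cq≤q) = begin
      2 * D * (c * q i)   ≤⟨ *-mono-≤ 2D≤q cq≤q ⟩
      q i * q i           ≤⟨ m≤m*n (q i * q i) ((q i * q i) ^ k) {{m^n≢0 (q i * q i) k {{m*n≢0 (q i) (q i) {{q≢0 (U i)}} {{q≢0 (U i)}}}}}} ⟩
      (q i * q i) ^ suc k ∎
      where
      2D≤q : 2 * D ≤ q i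
      2D≤q = begin
        2 * D                     ≤⟨ m≤m*n (2 * D) (2 ^ (2 + k)) {{m^n≢0 2 (2 + k)}} ⟩
        2 * D * 2 ^ (2 + k)       ≤⟨ m≤m*n _ _ {{m^n≢0 (2 * D * 2 ^ (2 + k)) (proj₁ (proj₂ gap)) {{m*n≢0 (2 * D) (2 ^ (2 + k)) {{_}} {{m^n≢0 2 (2 + k)}}}}}} ⟩
        N D                       ≤⟨ N≤q ⟩
        q i                       ∎
    few D i c N≤q (inj₂ cq≤) = ≤-trans (*-monoʳ-≤ (2 * D) cq≤)
      (^-cancelˡ-≤ e (2 * D * m₀ i ^ K) ((q i * q i) ^ suc k) (begin
        (2 * D * m₀ i ^ K) ^ e                        ≡⟨ *-^-distrib (2 * D) (m₀ i ^ K) e ⟩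
        (2 * D) ^ e * (m₀ i ^ K) ^ e                  ≡⟨ cong ((2 * D) ^ e *_) (^-^-comm (m₀ i) K e) ⟩
        (2 * D) ^ e * (m₀ i ^ e) ^ K                  ≤⟨ *-monoʳ-≤ ((2 * D) ^ e) (^-monoˡ-≤ K (proj₂ (proj₂ (proj₂ gap)) (m₀ i) 2 (q i) (proj₁ (approx i)))) ⟩
        (2 * D) ^ e * (2 ^ e * q i ^ u) ^ K           ≡⟨ cong ((2 * D) ^ e *_) (*-^-distrib (2 ^ e) (q i ^ u) K) ⟩
        (2 * D) ^ e * ((2 ^ e) ^ K * (q i ^ u) ^ K)   ≡⟨ cong₂ (λ x y → (2 * D) ^ e * (x * y)) (^-^-comm 2 e K) (^-*-assoc (q i) u K) ⟩
        (2 * D) ^ e * ((2 ^ K) ^ e * q i ^ (u * K))   ≡⟨ *-assoc ((2 * D) ^ e) ((2 ^ K) ^ e) _ ⟨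
        (2 * D) ^ e * (2 ^ K) ^ e * q i ^ (u * K)     ≡⟨ cong (_* q i ^ (u * K)) (*-^-distrib (2 * D) (2 ^ K) e) ⟨
        N D * q i ^ (u * K)                           ≤⟨ *-monoˡ-≤ (q i ^ (u * K)) N≤q ⟩
        q i ^ suc (u * K)                             ≤⟨ ^-monoʳ-≤ (q i) {{q≢0 (U i)}} (proj₁ (proj₂ (proj₂ gap))) ⟩
        q i ^ (2 * suc k * e)                         ≡⟨ ^-*-assoc (q i) (2 * suc k) e ⟨
        (q i ^ (2 * suc k)) ^ e                       ≡⟨ cong (_^ e) (square (q i) (suc k)) ⟨
        ((q i * q i) ^ suc k) ^ e                     ∎))
      where K = 2 + k

  select-strip : ∀ {R q l Q} (L : Local R q l Q) → ∀ m₀ → m₀ ≤ 4 * (Units.φ (Local.units L) * Q) →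
    Σ[ S ∈ Selection R m₀ ] (∀ k {c} → 𝒞 R (2 + k) (Selection.subset S) HasSize c →
                                  c ≤ suc l * (suc k * (Q ^ suc k * Q ^ k)))
  select-strip {R} {q} {l} {Q} L m₀ m₀≤4φQ = record
    { subset = image (strip m≤φQ)
    ; size   = image-size (strip m≤φQ) (strip-injective m≤φQ)
    ; m≤m₀   = m⊓n≤m m₀ (φ * Q)
    ; m₀≤4m  = m₀≤4m
    } , strip-classes m≤φQ
    where
    open Strip L
    open FinitePlane R
    φ = Units.φ (Local.units L)
    m≤φQ = m⊓n≤n m₀ (φ * Q)

    m₀≤4m : m₀ ≤ 4 * (m₀ ⊓ (φ * Q))
    m₀≤4m with ⊓-sel m₀ (φ * Q)
    ... | inj₁ eq = subst (λ m → m₀ ≤ 4 * m) (sym eq) (m≤n*m m₀ 4)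
    ... | inj₂ eq = subst (λ m → m₀ ≤ 4 * m) (sym eq) m₀≤4φQ

  -- The bound on `s` is what makes the points fit: the strip has φ Q points, at least half of q Q =
  -- b ^ (2 l + 1) = q ^ (2 - 1 / (l + 1)).
  strip-case : ∀ {a} {I : Set a} (R : I → CommutativeRing 0ℓ 0ℓ) (b : I → ℕ) → (∀ i → NonZero (b i)) →
    ∀ l → (∀ i → Local (R i) (b i ^ suc l) l (b i ^ l)) →
    ∀ k s → 0ℚ ≤ᵣ s → s <ᵣ + 2 ℚ./ 1 ℚ.- + 1 ℚ./ suc l →
    Σ[ E ∈ (∀ i → Subset (R i)) ]
        (Size (λ i → ⟦ R i ∣ E i ⟧) ≈ (λ i → b i ^ suc l) ^ s)
      × (Size (λ i → 𝒞 (R i) (2 + k) (E i)) ≪ (λ i → 𝒞 (R i) (2 + k) (full (R i))) as b →∞)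
  strip-case {I = I} R b b≢0 l L k s 0≤s s<x =
    (λ i → Selection.subset (S i)) , selection-≈ q s m₀ approx S
    , ≪-intro R q b U (2 + k) (λ i → Selection.subset (S i)) (λ i → Selection.size (S i)) λ D →
        2 * D * (suc l * suc k) , λ i N≤b {c} sizeC sizeN →
          few-classes (U i) k D {c} sizeN (few i D c N≤b (proj₂ (selected i) k sizeC))
    where
    open Cut s
    open ≤-Reasoning

    x≃ : toℚᵘ (+ 2 ℚ./ 1 ℚ.- + 1 ℚ./ suc l) ℚᵘ.≃ mkℚᵘ (+ (2 * l + 1)) l
    x≃ = two-minus 1 (2 * l + 1) l (lemma l)
      where
      lemma : ∀ l → 2 * l + 1 + 1 ≡ 2 * suc l
      lemma = ℕ.solve-∀

    module _ (i : I) where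
      Q q : ℕ
      Q = b i ^ l
      q = b i ^ suc l

      U : Units (R i) q
      U = Local.units (L i)

      open Units U using (φ; q≤2φ)

      approximated = approximation 0≤s q {{q≢0 U}}
      m₀ = proj₁ approximated
      approx = proj₂ (proj₂ approximated)

      m₀≤4φQ : m₀ ≤ 4 * (φ * Q)
      m₀≤4φQ = begin
        m₀                        ≤⟨ ^-cancelˡ-≤ (suc l) m₀ (2 * b i ^ (2 * l + 1)) (begin
          m₀ ^ suc l                                ≤⟨ bounded-by 0≤s x≃ s<x m₀ 2 q (proj₁ approx) ⟩
          2 ^ suc l * q ^ (2 * l + 1)               ≡⟨ cong (2 ^ suc l *_) (^-^-comm (b i) (suc l) (2 * l + 1)) ⟩
          2 ^ suc l * (b i ^ (2 * l + 1)) ^ suc l   ≡⟨ *-^-distrib 2 (b i ^ (2 * l + 1)) (suc l) ⟨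
          (2 * b i ^ (2 * l + 1)) ^ suc l           ∎) ⟩
        2 * b i ^ (2 * l + 1)     ≡⟨ cong (λ e → 2 * b i ^ e) (exponent l) ⟩
        2 * b i ^ (suc l + l)     ≡⟨ cong (2 *_) (^-distribˡ-+-* (b i) (suc l) l) ⟩
        2 * (q * Q)               ≤⟨ *-monoʳ-≤ 2 (*-monoˡ-≤ Q q≤2φ) ⟩
        2 * (2 * φ * Q)           ≡⟨ lemma φ Q ⟩
        4 * (φ * Q)               ∎
        where
        exponent : ∀ l → 2 * l + 1 ≡ suc l + l
        exponent = ℕ.solve-∀
        lemma : ∀ φ Q → 2 * (2 * φ * Q) ≡ 4 * (φ * Q)
        lemma = ℕ.solve-∀

      selected = select-strip (L i) m₀ m₀≤4φQ
      S = proj₁ selected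

      -- Trading q for Q saves 2 k + 1 factors of b. One of them absorbs the constant 2 D (l + 1) (k
      -- + 1), and the others are at least 1.
      few : ∀ D c → 2 * D * (suc l * suc k) ≤ b i → c ≤ suc l * (suc k * (Q ^ suc k * Q ^ k)) →
            2 * D * (c * q) ≤ (q * q) ^ suc k
      few D c N≤b c≤ = begin
        2 * D * (c * q)                                           ≤⟨ *-monoʳ-≤ (2 * D) (*-monoˡ-≤ q c≤) ⟩
        2 * D * (suc l * (suc k * (Q ^ suc k * Q ^ k)) * (b i * Q)) ≡⟨ lemma D (suc l) (suc k) Q (Q ^ k) (b i) ⟩
        2 * D * (suc l * suc k) * b i * (Q ^ suc k * Q ^ suc k)   ≤⟨ *-monoˡ-≤ _ (*-monoˡ-≤ (b i) N≤b) ⟩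
        b i * b i * (Q ^ suc k * Q ^ suc k)                       ≤⟨ *-monoˡ-≤ _ (m≤m*n (b i * b i) ((b i * b i) ^ k) {{bb^k≢0}}) ⟩
        (b i * b i) ^ suc k * (Q ^ suc k * Q ^ suc k)             ≡⟨ cong ((b i * b i) ^ suc k *_) (*-^-distrib Q Q (suc k)) ⟨
        (b i * b i) ^ suc k * (Q * Q) ^ suc k                     ≡⟨ *-^-distrib (b i * b i) (Q * Q) (suc k) ⟨
        (b i * b i * (Q * Q)) ^ suc k                             ≡⟨ cong (_^ suc k) (interchange (b i) Q) ⟩
        (q * q) ^ suc k                                           ∎
        where
        bb^k≢0 = m^n≢0 (b i * b i) k {{m*n≢0 (b i) (b i) {{b≢0 i}} {{b≢0 i}}}}
        lemma : ∀ D l k Q X p → 2 * D * (l * (k * (Q * X * X)) * (p * Q)) ≡ 2 * D * (l * k) * p * (Q * X * (Q * X))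
        lemma = ℕ.solve-∀
        interchange : ∀ p Q → p * p * (Q * Q) ≡ p * Q * (p * Q)
        interchange = ℕ.solve-∀

-- The two families of rings

open Asymptotics
open Rings
open Classes
open import Data.Integer.Base using (+_)
open import Data.Nat.Base using (ℕ; zero; suc; _≤_; _^_; NonZero; s≤s; ≢-nonZero⁻¹)
open import Data.Nat.Base as ℕ using ()
open import Data.Nat.Properties using (≤-refl; ≤-trans; ≤-reflexive; *-identityʳ; ^-monoʳ-≤)
open import Data.Nat.Primality using (Prime; prime⇒nonTrivial; prime⇒nonZero)
open import Data.Product.Base using (Σ-syntax; _×_; _,_)
open import Data.Rational.Base using (0ℚ; _/_; _-_; _⊓_)
import Data.Rational.Properties as ℚ
open import Data.Sum.Base using (inj₁; inj₂)
open import Relation.Binary.PropositionalEquality as ≡ using (_≡_; refl; subst)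
open import Relation.Nullary using (contradiction)

prime≤power : ∀ {p} → Prime p → ∀ n → 1 ≤ n → p ≤ p ^ n
prime≤power {p} isPrime n 1≤n =
  ≤-trans (≤-reflexive (≡.sym (*-identityʳ p))) (^-monoʳ-≤ p {{prime⇒nonZero isPrime}} 1≤n)

oddFieldUnits : ∀ F → Units (𝔽 F) (∣𝔽∣ F)
oddFieldUnits F = fieldUnits isField size
  (≤-trans (ℕ.nonTrivial⇒n>1 (p oddPrime) {{prime⇒nonTrivial isPrime}}) (prime≤power isPrime n 1≤n))
  where
  open OddFiniteField F
  open OddPrime oddPrime using (isPrime)

theorem3 : (k : ℕ) → 1 ≤ k →
    ( (s : ℝ) → 0ℚ ≤ᵣ s → s <ᵣ + 2 / 1 - + 2 / suc k →
    Σ[ E ∈ ((F : OddFiniteField) → Subset (𝔽 F)) ]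
    (Size (λ F → ⟦ 𝔽 F ∣ E F ⟧) ≈ ∣𝔽∣ ^ s)
    × (Size (λ F → 𝒞 (𝔽 F) (suc k) (E F))
    ≪ (λ F → 𝒞 (𝔽 F) (suc k) (full (𝔽 F))) as ∣𝔽∣ →∞) )
    × ( (ℓ : ℕ) → .{{_ : NonZero ℓ}} →
    (s : ℝ) → 0ℚ ≤ᵣ s → s <ᵣ + 2 / 1 - ((+ 2 / suc k) ⊓ (+ 1 / ℓ)) →
    Σ[ E ∈ ((P : OddPrime) → Subset (ℤ/ (p P ^ ℓ))) ]
    (Size (λ P → ⟦ ℤ/ (p P ^ ℓ) ∣ E P ⟧)
    ≈ (λ P → p P ^ ℓ) ^ s)
    × (Size (λ P → 𝒞 (ℤ/ (p P ^ ℓ)) (suc k) (E P))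
    ≪ (λ P → 𝒞 (ℤ/ (p P ^ ℓ)) (suc k) (full (ℤ/ (p P ^ ℓ))))
    as p →∞) )
theorem3 (suc k) _ = rows-case 𝔽 ∣𝔽∣ ∣𝔽∣ oddFieldUnits (λ _ → ≤-refl) k , primePowers
  where
  primePowers : (ℓ : ℕ) → .{{_ : NonZero ℓ}} → _
  primePowers zero {{ℓ≢0}} = contradiction refl (≢-nonZero⁻¹ 0 {{ℓ≢0}})
  -- The minimum of two rationals is one of them, so each construction only has to meet its own
  -- threshold.
  primePowers (suc l) s 0≤s s<x with ℚ.⊓-sel (+ 2 / (2 ℕ.+ k)) (+ 1 / suc l)
  ... | inj₁ eq = rows-case (λ P → ℤ/ (p P ^ suc l)) (λ P → p P ^ suc l) p
                    (λ P → primePowerUnits (OddPrime.isPrime P) l)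
                    (λ P → prime≤power (OddPrime.isPrime P) (suc l) (s≤s ℕ.z≤n)) k s 0≤s
                    (subst (λ x → s <ᵣ + 2 / 1 - x) eq s<x)
  ... | inj₂ eq = strip-case (λ P → ℤ/ (p P ^ suc l)) p (λ P → prime⇒nonZero (OddPrime.isPrime P)) l
                    (λ P → primePowerLocal (OddPrime.isPrime P) l) k s 0≤s
                    (subst (λ x → s <ᵣ + 2 / 1 - x) eq s<x)
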